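{- For all integers $n\ge 1$, $k\ge 2$ and $r\ge 2$, we have \[\mathrm{ex}_r(n, \text{Berge- }K_k) \le \max\{\mathrm{ex}(n, K_k),\ \mathrm{ex}(n, K_r, K_k)\}.\]
   Context: All graphs and hypergraphs are finite and simple. A hypergraph $\mathcal{H}$ contains a Berge-$F$ (Berge copy of the graph $F$) if there are an injection $\varphi:V(F)\to V(\mathcal{H})$ and an injection $f:E(F)\to E(\mathcal{H})$ with $\{\varphi(u),\varphi(v)\}\subset f(uv)$ for every edge $uv\in E(F)$; otherwise it is Berge-$F$-free. $\mathrm{ex}_r(n,\text{Berge- }F)$ is the maximum number of hyperedges in an $n$-vertex $r$-uniform Berge-$F$-free hypergraph. A graph is $F$-free if it has no (not necessarily induced) subgraph isomorphic to $F$. $\mathrm{ex}(n,F)$ is the maximum number of edges, and $\mathrm{ex}(n,H,F)$ the maximum number of copies of $H$, in an $n$-vertex $F$-free graph. -}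

module Defs where

open import Data.Bool.Properties using () renaming (_≟_ to _≟ᵇ_)
open import Data.Empty using (⊥-elim)
open import Data.Fin using (Fin; zero; suc)
open import Data.Fin.Properties using (any?; all?; injective⇒≤) renaming (_≟_ to _≟ᶠ_)
open import Data.Fin.Subset using (Subset; inside; outside; _∈_; _⊆_; ∣_∣; ⊤)
open import Data.Fin.Subset.Properties using (_∈?_; _⊆?_)
open import Data.List
  using (List; []; _∷_; _++_; map; filter; length; lookup; concatMap; cartesianProduct; cartesianProductWith; upTo)
open import Data.List.Extrema.Nat using (max; xs≤max; argmax-sel)
open import Data.List.Membership.Propositional using (lose) renaming (_∈_ to _∈ˡ_)
open import Data.List.Membership.Propositional.Properties
  using (∈-++⁺ˡ; ∈-++⁺ʳ; ∈-map⁺; ∈-map⁻; ∈-filter⁺; ∈-filter⁻; ∈-concatMap⁺; ∈-cartesianProductWith⁺; ∈-upTo⁺; ∈-lookup)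
open import Data.List.Relation.Unary.All as All using (All)
open import Data.List.Relation.Unary.All.Properties using (all-filter)
open import Data.List.Relation.Unary.AllPairs using ([]; _∷_)
open import Data.List.Relation.Unary.Any using (here)
open import Data.List.Relation.Unary.Any.Properties using (lookup-index)
open import Data.List.Relation.Unary.Unique.Propositional using (Unique)
open import Data.List.Relation.Unary.Unique.Propositional.Properties using (filter⁺; map⁺; ++⁺)
open import Data.List.Relation.Unary.Unique.DecSetoid using (unique?)
open import Data.Nat using (ℕ; zero; suc; _≤_; s≤s)
open import Data.Nat.Properties using (n≤0⇒n≡0) renaming (_≟_ to _≟ⁿ_)
open import Data.Product using (Σ-syntax; ∃-syntax; _×_; _,_; proj₂)
open import Data.Sum using (inj₁; inj₂)
open import Data.Vec as Vec using (tabulate)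
open import Data.Vec.Properties using (≡-dec; tabulate-cong; ∷-injectiveʳ; lookup⇒[]=; []=⇒lookup; lookup∘tabulate)
open import Data.Vec.Functional using () renaming (_∷_ to _∷ᶠ_)
open import Function using (_∘_; id; mk⇔; _↣_; mk↣; Injection)
open import Function.Definitions using (Injective)
open import Relation.Binary.PropositionalEquality
  using (_≡_; _≗_; refl; sym; trans; cong; subst; decSetoid)
open import Relation.Nullary using (¬_; Dec; yes; no; does)
open import Relation.Nullary.Decidable
  using (¬?; _×-dec_; _→-dec_; does-⇔; dec-true) renaming (map′ to mapDec)
open import Relation.Unary using (Decidable)

open Injection using (to; injective)

private variable
  a b n r s t : ℕ

_≟ˢ_ : (p q : Subset n) → Dec (p ≡ q)
_≟ˢ_ = ≡-dec _≟ᵇ_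

preimage? : (φ : Fin a → Fin b) (p : Subset a) (y : Fin b) → Dec (∃[ x ] (x ∈ p × φ x ≡ y))
preimage? φ p y = any? λ x → (x ∈? p) ×-dec (φ x ≟ᶠ y)

image : (Fin a → Fin b) → Subset a → Subset b
image φ p = tabulate λ y → does (preimage? φ p y)

subsets : ∀ n → List (Subset n)
subsets zero    = Vec.[] ∷ []
subsets (suc n) = map (outside Vec.∷_) (subsets n) ++ map (inside Vec.∷_) (subsets n)

subsets-complete : (p : Subset n) → p ∈ˡ subsets n
subsets-complete Vec.[]            = here refl
subsets-complete (outside Vec.∷ p) = ∈-++⁺ˡ (∈-map⁺ _ (subsets-complete p))
subsets-complete (inside Vec.∷ p)  = ∈-++⁺ʳ _ (∈-map⁺ _ (subsets-complete p))

subsets-unique : ∀ n → Unique (subsets n)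
subsets-unique zero    = All.[] ∷ []
subsets-unique (suc n) =
  ++⁺ (map⁺ ∷-injectiveʳ (subsets-unique n)) (map⁺ ∷-injectiveʳ (subsets-unique n)) disjoint
  where
  disjoint : ∀ {p} → ¬ (p ∈ˡ map (outside Vec.∷_) (subsets n) × p ∈ˡ map (inside Vec.∷_) (subsets n))
  disjoint (x , y) with ∈-map⁻ _ x | ∈-map⁻ _ y
  ... | _ , _ , refl | _ , _ , ()

-- An r-uniform hypergraph with vertex set Fin n. The order of the list of
-- hyperedges carries no meaning.
record Hypergraph (r n : ℕ) : Set where
  constructor hypergraph
  field
    edges   : List (Subset n)
    unique  : Unique edges
    uniform : All (λ e → ∣ e ∣ ≡ r) edges

open Hypergraph public

Graph : ℕ → Set
Graph = Hypergraph 2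

size : Hypergraph r n → ℕ
size H = length (edges H)

E : Hypergraph r n → Set
E H = Fin (size H)

_‼_ : (H : Hypergraph r n) → E H → Subset n
H ‼ i = lookup (edges H) i

K : ∀ k → Graph k
K k = record
  { edges   = filter (λ e → ∣ e ∣ ≟ⁿ 2) (subsets k)
  ; unique  = filter⁺ (λ e → ∣ e ∣ ≟ⁿ 2) (subsets-unique k)
  ; uniform = all-filter (λ e → ∣ e ∣ ≟ⁿ 2) (subsets k)
  }

-- Since edges of a graph F have exactly two vertices u and v, the inclusion
-- says that φ u and φ v both lie in the hyperedge f (uv).
BergeCopy : Graph a → Hypergraph r n → Set
BergeCopy {a = a} {n = n} F H =
  Σ[ φ ∈ Fin a ↣ Fin n ] Σ[ f ∈ E F ↣ E H ]
    (∀ i → image (to φ) (F ‼ i) ⊆ H ‼ to f i)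

BergeFree : Graph a → Hypergraph r n → Set
BergeFree F H = ¬ BergeCopy F H

IsEmbedding : (F : Graph a) (G : Graph n) → (Fin a → Fin n) → (E F → E G) → Set
IsEmbedding F G φ f = ∀ i → image φ (F ‼ i) ≡ G ‼ f i

Contains : Graph n → Graph a → Set
Contains {n = n} {a = a} G F =
  Σ[ φ ∈ Fin a ↣ Fin n ] Σ[ f ∈ E F ↣ E G ] IsEmbedding F G (to φ) (to f)

Free : Graph a → Graph n → Set
Free F G = ¬ Contains G F

-- The subgraph of G with vertex set S and edge set T is isomorphic to F.
IsCopy : (F : Graph a) (G : Graph n) → Subset n × Subset (size G) → Set
IsCopy {a = a} {n = n} F G (S , T) =
  Σ[ φ ∈ Fin a ↣ Fin n ] Σ[ f ∈ E F ↣ E G ]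
    (IsEmbedding F G (to φ) (to f) × image (to φ) ⊤ ≡ S × image (to f) ⊤ ≡ T)

image-cong : {φ ψ : Fin a → Fin b} → φ ≗ ψ → (p : Subset a) → image φ p ≡ image ψ p
image-cong {φ = φ} {ψ = ψ} φ≗ψ p = tabulate-cong λ y → does-⇔
  (mk⇔ (λ (x , x∈p , eq) → x , x∈p , trans (sym (φ≗ψ x)) eq)
       (λ (x , x∈p , eq) → x , x∈p , trans (φ≗ψ x) eq))
  (preimage? φ p y) (preimage? ψ p y)

∈-image⁺ : (φ : Fin a → Fin b) {p : Subset a} → ∀ {x} → x ∈ p → φ x ∈ image φ p
∈-image⁺ φ {x = x} x∈p = lookup⇒[]= _ _
  (trans (lookup∘tabulate _ (φ x)) (dec-true (preimage? φ _ (φ x)) (x , x∈p , refl)))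

∈-image⁻ : (φ : Fin a → Fin b) (p : Subset a) → ∀ {y} → y ∈ image φ p → ∃[ x ] (x ∈ p × φ x ≡ y)
∈-image⁻ φ p {y} y∈ = witness (preimage? φ p y) (trans (sym (lookup∘tabulate _ y)) ([]=⇒lookup y∈))
  where
  witness : ∀ {A : Set} (d : Dec A) → does d ≡ inside → A
  witness (yes x) _ = x

anyFunction? : (P : (Fin a → Fin b) → Set) → (∀ {φ ψ} → φ ≗ ψ → P φ → P ψ) →
               Decidable P → Dec (∃[ φ ] P φ)
anyFunction? {a = zero}  P resp P? = mapDec (_ ,_) (λ (φ , p) → resp (λ ()) p) (P? λ ())
anyFunction? {a = suc a} P resp P? =
  mapDec (λ (x , φ , p) → (x ∷ᶠ φ) , p)
         (λ (φ , p) → φ zero , φ ∘ suc , resp (λ { zero → refl ; (suc _) → refl }) p)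
         (any? λ x → anyFunction? (λ φ → P (x ∷ᶠ φ))
           (λ φ≗ψ → resp λ { zero → refl ; (suc i) → φ≗ψ i }) (λ φ → P? (x ∷ᶠ φ)))

injective? : Decidable (Injective {A = Fin a} {B = Fin b} _≡_ _≡_)
injective? φ = mapDec (λ inj {x} {y} → inj x y) (λ inj x y → inj {x} {y})
  (all? λ x → all? λ y → (φ x ≟ᶠ φ y) →-dec (x ≟ᶠ y))

anyInjection? : (P : (Fin a → Fin b) → Set) → (∀ {φ ψ} → φ ≗ ψ → P φ → P ψ) →
                Decidable P → Dec (Σ[ φ ∈ Fin a ↣ Fin b ] P (to φ))
anyInjection? P resp P? =
  mapDec (λ (φ , inj , p) → mk↣ {to = φ} inj , p) (λ (φ , p) → to φ , (λ {x} {y} → injective φ {x} {y}) , p)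
    (anyFunction? (λ φ → Injective _≡_ _≡_ φ × P φ)
      (λ φ≗ψ (inj , p) → (λ {x} {y} eq → inj (trans (φ≗ψ x) (trans eq (sym (φ≗ψ y))))) , resp φ≗ψ p)
      (λ φ → injective? φ ×-dec P? φ))

anyInjections? : (P : (Fin a → Fin b) → (Fin s → Fin t) → Set) →
                 (∀ {φ ψ f g} → φ ≗ ψ → f ≗ g → P φ f → P ψ g) → (∀ φ f → Dec (P φ f)) →
                 Dec (Σ[ φ ∈ Fin a ↣ Fin b ] Σ[ f ∈ Fin s ↣ Fin t ] P (to φ) (to f))
anyInjections? P resp P? =
  anyInjection? (λ φ → Σ[ f ∈ Fin _ ↣ Fin _ ] P φ (to f))
    (λ φ≗ψ (f , p) → f , resp φ≗ψ (λ _ → refl) p)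
    (λ φ → anyInjection? (P φ) (resp (λ _ → refl)) (P? φ))

isEmbedding-resp : (F : Graph a) (G : Graph n) → ∀ {φ ψ f g} → φ ≗ ψ → f ≗ g →
                   IsEmbedding F G φ f → IsEmbedding F G ψ g
isEmbedding-resp F G φ≗ψ f≗g emb i =
  trans (sym (image-cong φ≗ψ (F ‼ i))) (trans (emb i) (cong (G ‼_) (f≗g i)))

isEmbedding? : (F : Graph a) (G : Graph n) → ∀ φ f → Dec (IsEmbedding F G φ f)
isEmbedding? F G φ f = all? λ i → image φ (F ‼ i) ≟ˢ (G ‼ f i)

bergeCopy? : (F : Graph a) (H : Hypergraph r n) → Dec (BergeCopy F H)
bergeCopy? F H = anyInjections? (λ φ f → ∀ i → image φ (F ‼ i) ⊆ H ‼ f i)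
  (λ φ≗ψ f≗g sub i {x} x∈ → subst (x ∈_) (cong (H ‼_) (f≗g i))
    (sub i (subst (x ∈_) (sym (image-cong φ≗ψ (F ‼ i))) x∈)))
  (λ φ f → all? λ i → image φ (F ‼ i) ⊆? (H ‼ f i))

contains? : (F : Graph a) (G : Graph n) → Dec (Contains G F)
contains? F G = anyInjections? (IsEmbedding F G) (isEmbedding-resp F G) (isEmbedding? F G)

bergeFree? : (F : Graph a) → Decidable (BergeFree {r = r} {n = n} F)
bergeFree? F H = ¬? (bergeCopy? F H)

free? : (F : Graph a) → Decidable (Free {n = n} F)
free? F G = ¬? (contains? F G)

isCopy? : (F : Graph a) (G : Graph n) → Decidable (IsCopy F G)
isCopy? F G (S , T) = anyInjections?
  (λ φ f → IsEmbedding F G φ f × image φ ⊤ ≡ S × image f ⊤ ≡ T)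
  (λ φ≗ψ f≗g (emb , eS , eT) → isEmbedding-resp F G φ≗ψ f≗g emb ,
    trans (sym (image-cong φ≗ψ ⊤)) eS , trans (sym (image-cong f≗g ⊤)) eT)
  (λ φ f → isEmbedding? F G φ f ×-dec (image φ ⊤ ≟ˢ S) ×-dec (image f ⊤ ≟ˢ T))

copies : Graph a → Graph n → ℕ
copies {n = n} F G = length (filter (isCopy? F G) (cartesianProduct (subsets n) (subsets (size G))))

lists : {A : Set} → List A → ℕ → List (List A)
lists xs zero    = [] ∷ []
lists xs (suc m) = cartesianProductWith _∷_ xs (lists xs m)

fromEdges : ∀ r n → List (Subset n) → List (Hypergraph r n)
fromEdges r n es with unique? (decSetoid _≟ˢ_) es | All.all? (λ e → ∣ e ∣ ≟ⁿ r) es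
... | yes u | yes un = hypergraph es u un ∷ []
... | _     | _      = []

-- Every r-uniform hypergraph on Fin n occurs, once for each ordering of its edges.
hypergraphs : ∀ r n → List (Hypergraph r n)
hypergraphs r n =
  concatMap (fromEdges r n) (concatMap (lists (subsets n)) (upTo (suc (length (subsets n)))))

-- Equal to 0 when nothing satisfies P; for a graph F with at least one edge,
-- empty hypergraphs are (Berge-)F-free, so this does not occur.
maximum : {P : Hypergraph r n → Set} → Decidable P → (Hypergraph r n → ℕ) → ℕ
maximum {r = r} {n = n} P? f = max 0 (map f (filter P? (hypergraphs r n)))

exBerge : ∀ r n → Graph a → ℕ
exBerge r n F = maximum (bergeFree? {r = r} {n = n} F) size

ex : ∀ n → Graph a → ℕ
ex n F = maximum (free? {n = n} F) size

exCopies : ∀ n → Graph b → Graph a → ℕ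
exCopies n H F = maximum (free? {n = n} F) (copies H)

lists-complete : ∀ {A : Set} {xs : List A} → (∀ x → x ∈ˡ xs) → (ys : List A) → ys ∈ˡ lists xs (length ys)
lists-complete full []       = here refl
lists-complete full (y ∷ ys) = ∈-cartesianProductWith⁺ _∷_ (full y) (lists-complete full ys)

lookup-injective : ∀ {A : Set} {xs : List A} → Unique xs → ∀ {i j} → lookup xs i ≡ lookup xs j → i ≡ j
lookup-injective {xs = _ ∷ _}  _        {zero}  {zero}  _  = refl
lookup-injective {xs = _ ∷ xs} (x∉ ∷ _) {zero}  {suc j} eq = ⊥-elim (All.lookup x∉ (∈-lookup j) eq)
lookup-injective {xs = _ ∷ xs} (x∉ ∷ _) {suc i} {zero}  eq = ⊥-elim (All.lookup x∉ (∈-lookup i) (sym eq))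
lookup-injective {xs = _ ∷ _}  (_ ∷ u)  {suc i} {suc j} eq = cong suc (lookup-injective u eq)

unique⇒length≤ : ∀ {A : Set} {xs ys : List A} → (∀ x → x ∈ˡ xs) → Unique ys → length ys ≤ length xs
unique⇒length≤ {xs = xs} {ys} full u = injective⇒≤ λ {i} {j} eq → lookup-injective u
  (trans (lookup-index (full (lookup ys i)))
    (trans (cong (lookup xs) eq) (sym (lookup-index (full (lookup ys j))))))

fromEdges-complete : (H : Hypergraph r n) → ∃[ H′ ] (H′ ∈ˡ fromEdges r n (edges H) × edges H′ ≡ edges H)
fromEdges-complete {r = r} (hypergraph es u un)
  with unique? (decSetoid _≟ˢ_) es | All.all? (λ e → ∣ e ∣ ≟ⁿ r) es
... | yes _ | yes _   = _ , here refl , refl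
... | yes _ | no ¬un  = ⊥-elim (¬un un)
... | no ¬u | _       = ⊥-elim (¬u u)

hypergraphs-complete : (H : Hypergraph r n) → ∃[ H′ ] (H′ ∈ˡ hypergraphs r n × edges H′ ≡ edges H)
hypergraphs-complete {r = r} {n = n} H with fromEdges-complete H
... | H′ , H′∈ , eq = H′ , ∈-concatMap⁺ (fromEdges r n) (lose edges∈ H′∈) , eq
  where
  edges∈ : edges H ∈ˡ concatMap (lists (subsets n)) (upTo (suc (length (subsets n))))
  edges∈ = ∈-concatMap⁺ (lists (subsets n))
    (lose (∈-upTo⁺ (s≤s (unique⇒length≤ subsets-complete (unique H)))) (lists-complete subsets-complete (edges H)))

IsMaximum : (Hypergraph r n → Set) → (Hypergraph r n → ℕ) → ℕ → Set
IsMaximum P f m = (∀ H → P H → f H ≤ m) × (∃[ H ] P H → ∃[ H ] (P H × f H ≡ m))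

maximum-isMaximum : {P : Hypergraph r n → Set} (P? : Decidable P) (f : Hypergraph r n → ℕ) →
                    (∀ {H H′} → edges H ≡ edges H′ → P H → P H′) →
                    (∀ {H H′} → edges H ≡ edges H′ → f H ≡ f H′) →
                    IsMaximum P f (maximum P? f)
maximum-isMaximum {r = r} {n = n} {P} P? f P-resp f-resp = bound , attained
  where
  Hs = filter P? (hypergraphs r n)

  bound : ∀ H → P H → f H ≤ maximum P? f
  bound H pH with hypergraphs-complete H
  ... | H′ , H′∈ , eq = subst (_≤ maximum P? f) (f-resp eq)
    (All.lookup (xs≤max 0 (map f Hs)) (∈-map⁺ f (∈-filter⁺ P? H′∈ (P-resp (sym eq) pH))))

  attained : ∃[ H ] P H → ∃[ H ] (P H × f H ≡ maximum P? f)
  attained (H , pH) with argmax-sel id 0 (map f Hs)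
  ... | inj₁ max≡0 = H , pH , trans (n≤0⇒n≡0 (subst (f H ≤_) max≡0 (bound H pH))) (sym max≡0)
  ... | inj₂ max∈ with ∈-map⁻ f max∈
  ...   | H′ , H′∈ , eq = H′ , proj₂ (∈-filter⁻ P? {xs = hypergraphs r n} H′∈) , sym eq

exBerge-isMaximum : ∀ r n (F : Graph a) → IsMaximum (BergeFree {r = r} {n = n} F) size (exBerge r n F)
exBerge-isMaximum r n F = maximum-isMaximum (bergeFree? F) size (λ { refl → id }) (cong length)

ex-isMaximum : ∀ n (F : Graph a) → IsMaximum (Free {n = n} F) size (ex n F)
ex-isMaximum n F = maximum-isMaximum (free? F) size (λ { refl → id }) (cong length)

exCopies-isMaximum : ∀ n (H : Graph b) (F : Graph a) →
                     IsMaximum (Free {n = n} F) (copies H) (exCopies n H F)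
exCopies-isMaximum n H F = maximum-isMaximum (free? F) (copies H) (λ { refl → id }) (λ { refl → refl })

{-# OPTIONS --safe #-}

-- A König-type decomposition of the incidence graph between hyperedges and
-- vertex pairs splits the hyperedges into those that are cliques of a blue
-- graph and those matched to the edges of a red graph. All pairs used are
-- matched to distinct hyperedges, so a k-clique in the union of the two graphs
-- would give a Berge-K_k; hence it remains to bound e(red) + K_r(blue) when
-- red ∪ blue is K_k-free.
-- Zykov symmetrization makes red ∪ blue complete multipartite: of two
-- nonadjacent vertices, the one that contributes less passes its weight to the
-- other. On the parts, with their sizes as weights, the density K_s(blue) / e_s of
-- weighted s-cliques relative to the elementary symmetric polynomial decreases
-- in s, so K_r(blue) e_2 ≤ K_2(blue) e_r. Hence the extreme
-- cases are all edges red, which gives e_2, and all edges blue, which gives e_r.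

module Submission where

open import Defs
open import Data.Bool using (Bool; true; false; _∧_; _∨_; if_then_else_)
open import Data.Bool.Properties using (∧-assoc; ∧-comm; ∧-zeroʳ)
open import Data.Empty using (⊥-elim)
open import Data.Fin using (Fin; zero; suc)
open import Data.Fin.Properties using (injective⇒≤; suc-injective; 0≢1+n) renaming (_≟_ to _≟ᶠ_)
open import Data.Fin.Subset using (Subset; inside; outside; _∈_; _⊆_; ∣_∣; ⊤; ⊥)
open import Data.Fin.Subset.Properties using (∣⊥∣≡0; ∉⊥; ∈⊤; drop-∷-⊆; ⊆-antisym; _∈?_; _⊆?_)
open import Data.List
  using (List; []; _∷_; _++_; map; length; lookup; tabulate; filter; cartesianProduct; replicate)
open import Data.List.Extrema.Nat using (max≤v⁺)
open import Data.List.Membership.Propositional using (find; lose) renaming (_∈_ to _∈ˡ_; _∉_ to _∉ˡ_)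
open import Data.List.Membership.Propositional.Properties
  using (∈-++⁺ˡ; ∈-++⁺ʳ; ∈-++⁻; ∈-map⁺; ∈-map⁻; ∈-lookup; ∈-filter⁺; ∈-filter⁻; ∈-cartesianProduct⁺)
open import Data.List.Properties
  using (length-++; length-map; length-replicate; map-++; ++-assoc; ++-identityʳ; tabulate-lookup)
open import Data.List.Relation.Binary.Permutation.Propositional
  using (_↭_; ↭-refl; ↭-reflexive; ↭-sym; ↭-trans; ↭⇒↭ₛ; module PermutationReasoning)
import Data.List.Relation.Binary.Permutation.Propositional as ↭ using (refl; prep; swap; trans)
import Data.List.Relation.Binary.Permutation.Propositional.Properties as ↭
  using (map⁺; ++⁺ˡ; ++⁺ʳ; ++-comm; shift; ∈-resp-↭; All-resp-↭; ↭-length)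
open import Data.List.Relation.Binary.Permutation.Setoid.Properties using (Unique-resp-↭)
open import Data.List.Relation.Unary.All as All using (All; []; _∷_)
import Data.List.Relation.Unary.All.Properties as All
open import Data.List.Relation.Unary.AllPairs using (AllPairs; []; _∷_)
open import Data.List.Relation.Unary.Any as Any using (Any; here; there; index; any?)
open import Data.List.Relation.Unary.Any.Properties using (lookup-index)
open import Data.List.Relation.Unary.Unique.Propositional using (Unique)
import Data.List.Relation.Unary.Unique.Propositional.Properties as Unique
open import Data.Nat using (ℕ; zero; suc; _+_; _*_; _≤_; z≤n; s≤s; _⊔_)
open import Data.Nat.ListAction using (sum)
open import Data.Nat.ListAction.Properties using (sum-↭)
open import Data.Nat.Properties hiding (0≢1+n) renaming (suc-injective to suc-injectiveℕ)
open import Data.Nat.Tactic.RingSolver using (solve-∀)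
open import Data.Product using (_×_; _,_; proj₁; proj₂; ∃-syntax)
open import Data.Sum using (_⊎_; inj₁; inj₂)
open import Data.Vec using ([]; _∷_; here; there)
open import Data.Vec.Properties using (∷-injectiveʳ)
open import Function using (_∘_; id; _↣_; mk↣; mk⇔; Injection)
open import Relation.Binary using (DecidableEquality)
open import Relation.Binary.PropositionalEquality
  using (_≡_; _≢_; _≗_; refl; sym; trans; cong; cong₂; subst; setoid)
open import Relation.Nullary using (¬_; Dec; yes; no; does)
open import Relation.Nullary.Decidable using (¬?; _×-dec_; dec-true; dec-false; does-⇔)

open Injection using (to; injective)

private variable
  n : ℕ

-- Elementary symmetric polynomials and their log-concavity.

-- The elementary symmetric polynomial of degree `r`. For part sizes `ws` it counts the r-cliques of
-- the complete multipartite graph.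
esym : ℕ → List ℕ → ℕ
esym zero    ws       = 1
esym (suc r) []       = 0
esym (suc r) (w ∷ ws) = esym (suc r) ws + w * esym r ws

-- Induction on the weights, comparing coefficients of the powers of `w`. The two products at `w`
-- itself have gaps `t` and `t + 2` in place of `t + 1`, so the gap must be arbitrary. The classical
-- form is the case `t = 1`.
esym-logConcave : ∀ ws t {i j} → j ≤ i → esym (t + i) ws * esym j ws ≤ esym i ws * esym (t + j) ws
esym-logConcave ws zero {i} {j} _ = ≤-refl
esym-logConcave ws (suc t) {zero} z≤n = ≤-reflexive (*-comm (esym (suc t + 0) ws) 1)
esym-logConcave [] (suc t) {suc i} {j} _ = z≤n
esym-logConcave (w ∷ ws) (suc t) {suc i} {zero} _ = begin
  (e (suc (t + suc i)) + w * e (t + suc i)) * 1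
    ≡⟨ lhs (e (suc (t + suc i))) w (e (t + suc i)) ⟩
  e (suc (t + suc i)) * 1 + w * (e (t + suc i) * 1)
    ≤⟨ +-mono-≤ (esym-logConcave ws (suc t) z≤n) (*-monoʳ-≤ w (esym-logConcave ws t z≤n)) ⟩
  e (suc i) * e (suc t + 0) + w * (e (suc i) * e (t + 0))
    ≤⟨ m≤m+n _ _ ⟩
  e (suc i) * e (suc t + 0) + w * (e (suc i) * e (t + 0)) + w * e i * (e (suc t + 0) + w * e (t + 0))
    ≡⟨ rhs (e (suc i)) (e (suc t + 0)) w (e (t + 0)) (e i) ⟩
  (e (suc i) + w * e i) * (e (suc t + 0) + w * e (t + 0)) ∎
  where
  open ≤-Reasoning
  e : ℕ → ℕ
  e r = esym r ws
  lhs : ∀ a w b → (a + w * b) * 1 ≡ a * 1 + w * (b * 1)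
  lhs = solve-∀
  rhs : ∀ a b w c d → a * b + w * (a * c) + w * d * (b + w * c) ≡ (a + w * d) * (b + w * c)
  rhs = solve-∀
esym-logConcave (w ∷ ws) (suc t) {suc i} {suc j} (s≤s j≤i) = begin
  (e (suc t + suc i) + w * e (t + suc i)) * (e (suc j) + w * e j)
    ≡⟨ expand (e (suc t + suc i)) w (e (t + suc i)) (e (suc j)) (e j) ⟩
  e (suc t + suc i) * e (suc j) + w * (e (t + suc i) * e (suc j))
    + w * (e (suc t + suc i) * e j) + w * w * (e (t + suc i) * e j)
    ≤⟨ +-mono-≤ (+-mono-≤ (+-mono-≤
         (esym-logConcave ws (suc t) (s≤s j≤i))
         (*-monoʳ-≤ w (esym-logConcave ws t (s≤s j≤i))))
         (*-monoʳ-≤ w shift₂)) (*-monoʳ-≤ (w * w) shift₁) ⟩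
  e (suc i) * e (suc t + suc j) + w * (e (suc i) * e (t + suc j))
    + w * (e i * e (suc t + suc j)) + w * w * (e i * e (t + suc j))
    ≡⟨ factor (e (suc i)) (e (suc t + suc j)) w (e (t + suc j)) (e i) ⟩
  (e (suc i) + w * e i) * (e (suc t + suc j) + w * e (t + suc j)) ∎
  where
  open ≤-Reasoning
  e : ℕ → ℕ
  e r = esym r ws
  shift₁ : e (t + suc i) * e j ≤ e i * e (t + suc j)
  shift₁ rewrite +-suc t i | +-suc t j = esym-logConcave ws (suc t) j≤i
  shift₂ : e (suc t + suc i) * e j ≤ e i * e (suc t + suc j)
  shift₂ rewrite +-suc t i | +-suc t j = esym-logConcave ws (suc (suc t)) j≤i
  expand : ∀ a w b c d → (a + w * b) * (c + w * d) ≡ a * c + w * (b * c) + w * (a * d) + w * w * (b * d)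
  expand = solve-∀
  factor : ∀ a b w c d → a * b + w * (a * c) + w * (d * b) + w * w * (d * c) ≡ (a + w * d) * (b + w * c)
  factor = solve-∀

-- Natural weights give e_r = 0 only when fewer than r of them are positive. This covers the case in
-- which `density-cross` cannot cancel the factor e_r.
esym-vanish : ∀ ws r → esym r ws ≡ 0 → esym (suc r) ws ≡ 0
esym-vanish ws       zero    ()
esym-vanish []       (suc r) _  = refl
esym-vanish (w ∷ ws) (suc r) eq = cong₂ _+_ (esym-vanish ws (suc r) eq′) (trans (cong (w *_) eq′) (*-zeroʳ w))
  where
  eq′ : esym (suc r) ws ≡ 0
  eq′ = m+n≡0⇒m≡0 _ eq

-- Weighted clique counts and their densities.

-- The mixed term in the induction on the vertices for density-anti, where d counts
-- cliques in the deletion and l in the link of a vertex.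
density-cross : (e d l : ℕ → ℕ) → ∀ s r →
        d r * e s ≤ d s * e r → d (suc r) * e r ≤ d r * e (suc r) →
        l r ≤ d r → ∀ s′ → l r * e s′ ≤ l s′ * e r → e (suc r) * e s′ ≤ e r * e s →
        (e r ≡ 0 → d (suc r) ≡ 0 × l r ≡ 0) →
        d (suc r) * e s′ + l r * e s ≤ d s * e r + l s′ * e (suc r)
density-cross e d l s r ds dr l≤d s′ ls lc vanish with e r in er
... | zero rewrite proj₁ (vanish refl) | proj₂ (vanish refl) = z≤n
-- After multiplication by `e r`, `dr` turns the left side into a combination of `d r` and `l r`.
-- Since `l r ≤ d r`, the rearrangement inequality puts the larger product of `lc` on `d r`; then
-- `ds` and `ls` apply.
... | suc x = *-cancelʳ-≤ _ _ (suc x) (begin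
  (d (suc r) * e s′ + l r * e s) * y              ≡⟨ r₁ (d (suc r)) (e s′) (l r) (e s) y ⟩
  d (suc r) * y * e s′ + l r * (y * e s)          ≤⟨ +-monoˡ-≤ _ (*-monoˡ-≤ (e s′) dr) ⟩
  d r * e (suc r) * e s′ + l r * (y * e s)        ≡⟨ cong (_+ l r * (y * e s)) (*-assoc (d r) (e (suc r)) (e s′)) ⟩
  d r * (e (suc r) * e s′) + l r * (y * e s)      ≤⟨ rearrange l≤d lc ⟩
  d r * (y * e s) + l r * (e (suc r) * e s′)      ≡⟨ r₂ (d r) y (e s) (l r) (e (suc r)) (e s′) ⟩
  d r * e s * y + l r * e s′ * e (suc r)          ≤⟨ +-mono-≤ (*-monoˡ-≤ y ds) (*-monoˡ-≤ (e (suc r)) ls) ⟩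
  d s * y * y + l s′ * y * e (suc r)              ≡⟨ r₃ (d s) y (l s′) (e (suc r)) ⟩
  (d s * y + l s′ * e (suc r)) * y                ∎)
  where
  open ≤-Reasoning
  y = suc x
  r₁ : ∀ a b c d y → (a * b + c * d) * y ≡ a * y * b + c * (y * d)
  r₁ = solve-∀
  r₂ : ∀ a y b c d f → a * (y * b) + c * (d * f) ≡ a * b * y + c * f * d
  r₂ = solve-∀
  r₃ : ∀ a y c d → a * y * y + c * y * d ≡ (a * y + c * d) * y
  r₃ = solve-∀
  rearrange : ∀ {m n i j} → m ≤ n → i ≤ j → n * i + m * j ≤ n * j + m * i
  rearrange {m} {n} {i} {j} m≤n i≤j with m≤n⇒∃[o]m+o≡n m≤n | m≤n⇒∃[o]m+o≡n i≤j
  ... | o , refl | o′ , refl = subst ((m + o) * i + m * (i + o′) ≤_) (r₄ m o i o′) (m≤m+n _ (o * o′))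
    where
    r₄ : ∀ m o i o′ → (m + o) * i + m * (i + o′) + o * o′ ≡ (m + o) * (i + o′) + m * i
    r₄ = solve-∀

-- The weight of a clique is the product of the weights of its vertices;
-- p restricts the vertices that may be used.
cliques : {V : Set} → (V → V → Bool) → ℕ → (V → Bool) → List (V × ℕ) → ℕ
cliques b zero    p L             = 1
cliques b (suc r) p []            = 0
cliques b (suc r) p ((v , w) ∷ L) =
  cliques b (suc r) p L + w * (if p v then cliques b r (λ u → p u ∧ b v u) L else 0)

everywhere : {V : Set} → V → Bool
everywhere _ = true

weights : {V : Set} → List (V × ℕ) → List ℕ
weights = map proj₂

module _ {V : Set} (b : V → V → Bool) where

  cliques≤esym : ∀ r p L → cliques b r p L ≤ esym r (weights L)
  cliques≤esym zero    p L             = ≤-refl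
  cliques≤esym (suc r) p []            = z≤n
  cliques≤esym (suc r) p ((v , w) ∷ L) = +-mono-≤ (cliques≤esym (suc r) p L) (*-monoʳ-≤ w (link (p v)))
    where
    link : ∀ c → (if c then cliques b r (λ u → p u ∧ b v u) L else 0) ≤ esym r (weights L)
    link true  = cliques≤esym r _ L
    link false = z≤n

  cliques-mono : ∀ r {p q} → (∀ v → p v ≡ true → q v ≡ true) → ∀ L → cliques b r p L ≤ cliques b r q L
  cliques-mono zero    p⇒q L             = ≤-refl
  cliques-mono (suc r) p⇒q []            = z≤n
  cliques-mono (suc r) {p} {q} p⇒q ((v , w) ∷ L) = +-mono-≤ (cliques-mono (suc r) p⇒q L) (*-monoʳ-≤ w link)
    where
    restrict : ∀ u → p u ∧ b v u ≡ true → q u ∧ b v u ≡ true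
    restrict u h with p u in eq | h
    ... | true | h′ rewrite p⇒q u eq = h′
    link : (if p v then cliques b r (λ u → p u ∧ b v u) L else 0) ≤
           (if q v then cliques b r (λ u → q u ∧ b v u) L else 0)
    link with p v in eq
    ... | false = z≤n
    ... | true rewrite p⇒q v eq = cliques-mono r restrict L

  -- Induction on the vertex list: both sides are expanded in the weight `w` of the first vertex.
  -- The coefficients of 1 and `w * w` belong to the deletion and to the link alone; only the
  -- coefficient of `w` mixes them. The polynomials range over all of `L` whatever `p` is, so the
  -- link, which only shrinks `p`, falls under the same induction.
  density-anti : ∀ L p {s r} → s ≤ r →
                 cliques b r p L * esym s (weights L) ≤ cliques b s p L * esym r (weights L)
  density-anti L p {zero} {r} _ = subst (_≤ 1 * esym r (weights L)) (*-comm 1 (cliques b r p L))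
    (*-monoʳ-≤ 1 (cliques≤esym r p L))
  density-anti [] p {suc s} {suc r} _ = z≤n
  density-anti ((v , w) ∷ L) p {suc s} {suc r} (s≤s s≤r) with m≤n⇒m<n∨m≡n s≤r
  ... | inj₂ refl = ≤-refl
  -- The mixed term compares the sizes `suc s` and `r`, which is where `s < r` enters.
  ... | inj₁ s<r  = begin
    (d (suc r) + w * l r) * (e (suc s) + w * e s)
      ≡⟨ expand (d (suc r)) w (l r) (e (suc s)) (e s) ⟩
    d (suc r) * e (suc s) + w * (d (suc r) * e s + l r * e (suc s)) + w * w * (l r * e s)
      ≤⟨ +-mono-≤ (+-mono-≤ (density-anti L p (s≤s s≤r)) (*-monoʳ-≤ w middle)) (*-monoʳ-≤ (w * w) (link-anti s≤r)) ⟩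
    d (suc s) * e (suc r) + w * (d (suc s) * e r + l s * e (suc r)) + w * w * (l s * e r)
      ≡⟨ factor (d (suc s)) w (l s) (e (suc r)) (e r) ⟩
    (d (suc s) + w * l s) * (e (suc r) + w * e r) ∎
    where
    open ≤-Reasoning
    q : V → Bool
    q u = p u ∧ b v u
    e d l : ℕ → ℕ
    e i = esym i (weights L)
    d i = cliques b i p L
    l i = if p v then cliques b i q L else 0
    link-anti : ∀ {i j} → i ≤ j → l j * e i ≤ l i * e j
    link-anti i≤j with p v
    ... | true  = density-anti L q i≤j
    ... | false = z≤n
    q⇒p : ∀ u → q u ≡ true → p u ≡ true
    q⇒p u h with p u
    ... | true = refl
    link≤deletion : ∀ i → l i ≤ d i
    link≤deletion i with p v
    ... | true  = cliques-mono i q⇒p L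
    ... | false = z≤n
    vanish : e r ≡ 0 → d (suc r) ≡ 0 × l r ≡ 0
    vanish er = n≤0⇒n≡0 (subst (d (suc r) ≤_) (esym-vanish (weights L) r er) (cliques≤esym (suc r) p L)) ,
                n≤0⇒n≡0 (≤-trans (link≤deletion r) (subst (d r ≤_) er (cliques≤esym r p L)))
    middle : d (suc r) * e s + l r * e (suc s) ≤ d (suc s) * e r + l s * e (suc r)
    middle = density-cross e d l (suc s) r (density-anti L p s<r) (density-anti L p (n≤1+n r)) (link≤deletion r) s
      (link-anti s≤r) (esym-logConcave (weights L) 1 s≤r) vanish
    expand : ∀ a w b c d → (a + w * b) * (c + w * d) ≡ a * c + w * (a * d + b * c) + w * w * (b * d)
    expand = solve-∀
    factor : ∀ a w b c d → a * c + w * (a * d + b * c) + w * w * (b * d) ≡ (a + w * b) * (c + w * d)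
    factor = solve-∀

  cliques-cong : ∀ r {p q} → p ≗ q → ∀ L → cliques b r p L ≡ cliques b r q L
  cliques-cong r p≗q L = ≤-antisym
    (cliques-mono r (λ v h → trans (sym (p≗q v)) h) L) (cliques-mono r (λ v h → trans (p≗q v) h) L)

  -- The recursion tests `b` only from earlier to later entries, so reordering relies on symmetry.
  -- In a swap, the cliques through both entries live in the common neighbourhood, whichever entry
  -- comes first; the rest is arithmetic in each case.
  cliques-↭ : (∀ u v → b u v ≡ b v u) → ∀ r p {L L′} → L ↭ L′ → cliques b r p L ≡ cliques b r p L′
  cliques-↭ b-sym zero    p _          = refl
  cliques-↭ b-sym (suc r) p ↭.refl       = refl
  cliques-↭ b-sym (suc r) p (↭.trans π ρ) = trans (cliques-↭ b-sym (suc r) p π) (cliques-↭ b-sym (suc r) p ρ)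
  cliques-↭ b-sym (suc r) p (↭.prep (v , w) π) = cong₂ _+_ (cliques-↭ b-sym (suc r) p π)
    (cong (λ c → w * (if p v then c else 0)) (cliques-↭ b-sym r _ π))
  cliques-↭ b-sym (suc zero) p (↭.swap {L} {L′} (u , x) (v , y) π)
    rewrite cliques-↭ b-sym 1 p π =
    exchange (cliques b 1 p L′) (x * (if p u then 1 else 0)) (y * (if p v then 1 else 0))
    where
    exchange : ∀ a b c → a + c + b ≡ a + b + c
    exchange = solve-∀
  cliques-↭ b-sym (suc (suc r)) p (↭.swap {L} {L′} (u , x) (v , y) π)
    rewrite cliques-↭ b-sym (suc (suc r)) p π
          | cliques-↭ b-sym (suc r) (λ z → p z ∧ b u z) π | cliques-↭ b-sym (suc r) (λ z → p z ∧ b v z) π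
          | cliques-↭ b-sym r (λ z → (p z ∧ b u z) ∧ b v z) π
          | cliques-cong r {λ z → (p z ∧ b u z) ∧ b v z} {λ z → (p z ∧ b v z) ∧ b u z}
              (λ z → trans (∧-assoc (p z) _ _) (trans (cong (p z ∧_) (∧-comm (b u z) _)) (sym (∧-assoc (p z) _ _)))) L′
          | b-sym v u
    with p u | p v | b u v
  ... | true  | true  | true  = exchange (cliques b (suc (suc r)) p L′) x y _ _ _
    where
    exchange : ∀ a x y c d e → a + y * c + x * (d + y * e) ≡ a + x * d + y * (c + x * e)
    exchange = solve-∀
  ... | true  | true  | false = exchange (cliques b (suc (suc r)) p L′) x y _ _
    where
    exchange : ∀ a x y c d → a + y * c + x * (d + y * 0) ≡ a + x * d + y * (c + x * 0)
    exchange = solve-∀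
  ... | true  | false | c = exchange (cliques b (suc (suc r)) p L′) x y _
    where
    exchange : ∀ a x y d → a + y * 0 + x * (d + y * 0) ≡ a + x * d + y * 0
    exchange = solve-∀
  ... | false | true  | c = exchange (cliques b (suc (suc r)) p L′) x y _
    where
    exchange : ∀ a x y d → a + y * d + x * 0 ≡ a + x * 0 + y * (d + x * 0)
    exchange = solve-∀
  ... | false | false | c = exchange (cliques b (suc (suc r)) p L′) x y
    where
    exchange : ∀ a x y → a + y * 0 + x * 0 ≡ a + x * 0 + y * 0
    exchange = solve-∀

-- Every choice of `r` entries is a clique, so no term of the polynomial is lost.
cliques-pairwise : {V : Set} (b : V → V → Bool) → ∀ r {p} L → All (λ x → p (proj₁ x) ≡ true) L →
  AllPairs (λ x y → b (proj₁ x) (proj₁ y) ≡ true) L → cliques b r p L ≡ esym r (weights L)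
cliques-pairwise b zero    L  _ _ = refl
cliques-pairwise b (suc r) [] _ _ = refl
cliques-pairwise b (suc r) {p} ((v , w) ∷ L) (pv ∷ ps) (bv ∷ bs) rewrite pv = cong₂ _+_
  (cliques-pairwise b (suc r) L ps bs)
  (cong (w *_) (cliques-pairwise b r L (All.zipWith (λ (h , k) → cong₂ _∧_ h k) (ps , bv)) bs))

-- Zykov symmetrization of the two-coloured weighted graph.

findNonadjacent : {V : Set} (a : V → V → Bool) (L : List (V × ℕ)) →
  AllPairs (λ x y → a (proj₁ x) (proj₁ y) ≡ true) L ⊎
  ∃[ x ] ∃[ y ] ∃[ L′ ] (a (proj₁ x) (proj₁ y) ≡ false × L ↭ x ∷ y ∷ L′)
findNonadjacent a [] = inj₁ []
findNonadjacent {V} a (x ∷ L) with findNonadjacent a L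
... | inj₂ (y , z , L′ , eq , π) = inj₂ (y , z , x ∷ L′ , eq ,
  ↭.trans (↭.prep x π) (↭.trans (↭.swap x y ↭.refl) (↭.prep y (↭.swap x z ↭.refl))))
... | inj₁ pw with select L
  where
  select : ∀ L → All (λ y → a (proj₁ x) (proj₁ y) ≡ true) L ⊎
           ∃[ y ] ∃[ L′ ] (a (proj₁ x) (proj₁ y) ≡ false × L ↭ y ∷ L′)
  select [] = inj₁ []
  select (y ∷ L) with a (proj₁ x) (proj₁ y) in eq | select L
  ... | false | _                      = inj₂ (y , L , eq , ↭.refl)
  ... | true  | inj₁ all               = inj₁ (eq ∷ all)
  ... | true  | inj₂ (z , L′ , eq′ , π) = inj₂ (z , y ∷ L′ , eq′ , ↭.trans (↭.prep y π) (↭.swap y z ↭.refl))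
... | inj₁ all                = inj₁ (all ∷ pw)
... | inj₂ (y , L′ , eq , π)  = inj₂ (x , y , L′ , eq , ↭.prep x π)

module Symmetrization {V : Set} (red blue : V → V → Bool)
  (red-sym : ∀ u v → red u v ≡ red v u) (blue-sym : ∀ u v → blue u v ≡ blue v u)
  (exclusive : ∀ u v → red u v ≡ true → blue u v ≡ false) (r : ℕ) where

  adj : V → V → Bool
  adj u v = red u v ∨ blue u v

  -- The weighted form of e(red) + K_r(blue); throughout this module `r` is the uniformity minus
  -- two.
  value : List (V × ℕ) → ℕ
  value L = cliques red 2 everywhere L + cliques blue (suc (suc r)) everywhere L

  value-↭ : ∀ {L L′} → L ↭ L′ → value L ≡ value L′
  value-↭ π = cong₂ _+_ (cliques-↭ red red-sym 2 everywhere π) (cliques-↭ blue blue-sym (suc (suc r)) everywhere π)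

  -- What `v` contributes to `value` per unit of its weight.
  degree : V → List (V × ℕ) → ℕ
  degree v L = cliques red 1 (red v) L + cliques blue (suc r) (blue v) L

  value-∷ : ∀ v w L → value ((v , w) ∷ L) ≡ value L + w * degree v L
  value-∷ v w L = regroup (cliques red 2 everywhere L) w (cliques red 1 (red v) L)
    (cliques blue (suc (suc r)) everywhere L) (cliques blue (suc r) (blue v) L)
    where
    regroup : ∀ a w b c d → (a + w * b) + (c + w * d) ≡ (a + c) + w * (b + d)
    regroup = solve-∀

  -- No clique of either colour contains both `u` and `v`, so there is no term in `x * y`. With
  -- `x + y` fixed the value is affine, and `merge` moves all weight to the vertex of larger
  -- `degree`.
  value-nonadjacent : ∀ {u v} → adj u v ≡ false → ∀ x y L →
                      value ((u , x) ∷ (v , y) ∷ L) ≡ value L + y * degree v L + x * degree u L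
  value-nonadjacent {u} {v} uv x y L
    rewrite value-∷ u x ((v , y) ∷ L) | value-∷ v y L with red u v | blue u v | uv
  ... | false | false | refl = cong (λ c → value L + y * degree v L + x * c)
    (drop (cliques red 1 (red u) L) y (cliques blue (suc r) (blue u) L))
    where
    drop : ∀ a y b → a + y * 0 + (b + y * 0) ≡ a + b
    drop = solve-∀

  merge : ∀ {u v} → adj u v ≡ false → ∀ x y L →
          ∃[ z ] value ((u , x) ∷ (v , y) ∷ L) ≤ value ((z , x + y) ∷ L)
  merge {u} {v} uv x y L = choose (≤-total (degree u L) (degree v L))
    where
    open ≤-Reasoning
    collect : ∀ a y x d → a + y * d + x * d ≡ a + (x + y) * d
    collect = solve-∀
    bound : ∀ z → degree u L ≤ degree z L → degree v L ≤ degree z L →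
            value ((u , x) ∷ (v , y) ∷ L) ≤ value ((z , x + y) ∷ L)
    bound z du≤ dv≤ = begin
      value ((u , x) ∷ (v , y) ∷ L)                ≡⟨ value-nonadjacent uv x y L ⟩
      value L + y * degree v L + x * degree u L    ≤⟨ +-mono-≤ (+-monoʳ-≤ (value L) (*-monoʳ-≤ y dv≤)) (*-monoʳ-≤ x du≤) ⟩
      value L + y * degree z L + x * degree z L    ≡⟨ collect (value L) y x (degree z L) ⟩
      value L + (x + y) * degree z L               ≡⟨ value-∷ z (x + y) L ⟨
      value ((z , x + y) ∷ L)                      ∎
    choose : degree u L ≤ degree v L ⊎ degree v L ≤ degree u L →
             ∃[ z ] value ((u , x) ∷ (v , y) ∷ L) ≤ value ((z , x + y) ∷ L)
    choose (inj₁ du≤dv) = v , bound v du≤dv ≤-refl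
    choose (inj₂ dv≤du) = u , bound u ≤-refl dv≤du

  -- Each merge shortens the list, whose length `m` bounds, and preserves the total weight, which
  -- later becomes the number of vertices.
  symmetrize : ∀ m L → length L ≤ m → ∃[ L′ ] (value L ≤ value L′ × sum (weights L) ≡ sum (weights L′) ×
               AllPairs (λ x y → adj (proj₁ x) (proj₁ y) ≡ true) L′)
  symmetrize m L len with findNonadjacent adj L
  ... | inj₁ pw = L , ≤-refl , refl , pw
  ... | inj₂ ((u , x) , (v , y) , L₀ , uv , π) with m | ↭.↭-length π | merge uv x y L₀
  ... | zero  | eq | _ rewrite eq with () ← len
  ... | suc m | eq | z , le rewrite eq with symmetrize m ((z , x + y) ∷ L₀) (≤-pred len)
  ... | L′ , le′ , s , pw = L′ , ≤-trans (≤-reflexive (value-↭ π)) (≤-trans le le′) ,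
    trans (sum-↭ (↭.map⁺ proj₂ π)) (trans (sym (+-assoc x y _)) s) , pw

  -- No pair is both red and blue, so each product of two weights is counted at most once.
  red+blue≤esym : ∀ L → cliques red 2 everywhere L + cliques blue 2 everywhere L ≤ esym 2 (weights L)
  red+blue≤esym [] = z≤n
  red+blue≤esym ((v , w) ∷ L) = begin
    (cliques red 2 everywhere L + w * cliques red 1 (red v) L) + (cliques blue 2 everywhere L + w * cliques blue 1 (blue v) L)
      ≡⟨ regroup (cliques red 2 everywhere L) w (cliques red 1 (red v) L) (cliques blue 2 everywhere L) (cliques blue 1 (blue v) L) ⟩
    (cliques red 2 everywhere L + cliques blue 2 everywhere L) + w * (cliques red 1 (red v) L + cliques blue 1 (blue v) L)
      ≤⟨ +-mono-≤ (red+blue≤esym L) (*-monoʳ-≤ w (degrees L)) ⟩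
    esym 2 (weights L) + w * esym 1 (weights L) ∎
    where
    open ≤-Reasoning
    regroup : ∀ a w b c d → (a + w * b) + (c + w * d) ≡ (a + c) + w * (b + d)
    regroup = solve-∀
    one : ∀ c d → (c ≡ true → d ≡ false) → ∀ a b x e → a + b ≤ e →
          a + x * (if c then 1 else 0) + (b + x * (if d then 1 else 0)) ≤ e + x * 1
    one true  true  ex a b x e le with () ← ex refl
    one true  false _  a b x e le = subst (_≤ e + x * 1) (eq a x b) (+-monoˡ-≤ (x * 1) le)
      where
      eq : ∀ a x b → a + b + x * 1 ≡ a + x * 1 + (b + x * 0)
      eq = solve-∀
    one false true  _  a b x e le = subst (_≤ e + x * 1) (eq a x b) (+-monoˡ-≤ (x * 1) le)
      where
      eq : ∀ a x b → a + b + x * 1 ≡ a + x * 0 + (b + x * 1)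
      eq = solve-∀
    one false false _  a b x e le = subst (_≤ e + x * 1) (eq a x b) (+-mono-≤ le z≤n)
      where
      eq : ∀ a x b → a + b + 0 ≡ a + x * 0 + (b + x * 0)
      eq = solve-∀
    degrees : ∀ L → cliques red 1 (red v) L + cliques blue 1 (blue v) L ≤ esym 1 (weights L)
    degrees [] = z≤n
    degrees ((u , x) ∷ L) = one (red v u) (blue v u) (exclusive v u)
      (cliques red 1 (red v) L) (cliques blue 1 (blue v) L) x (esym 1 (weights L)) (degrees L)

  -- With red count R and blue edge count B₂, `density-anti` bounds the value by (R / e_2) e_2 + (B₂
  -- / e_2) e_r. The two coefficients sum to at most 1, so the larger of e_2 and e_r is a bound.
  monochromatic : ∀ L → value L ≤ esym 2 (weights L) ⊔ esym (suc (suc r)) (weights L)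
  monochromatic L with esym 2 (weights L) in e₂
  -- If e_2 is zero there is no division, but the red count vanishes too and the blue count is at
  -- most e_r.
  ... | zero = subst (_≤ esym (suc (suc r)) (weights L)) (cong (_+ cliques blue (suc (suc r)) everywhere L) (sym red≡0))
    (cliques≤esym blue (suc (suc r)) everywhere L)
    where
    red≡0 : cliques red 2 everywhere L ≡ 0
    red≡0 = n≤0⇒n≡0 (subst (cliques red 2 everywhere L ≤_) e₂ (cliques≤esym red 2 everywhere L))
  ... | suc x = *-cancelʳ-≤ _ _ (suc x) (begin
    (R + B) * suc x              ≡⟨ *-distribʳ-+ (suc x) R B ⟩
    R * suc x + B * suc x        ≤⟨ +-mono-≤ (*-monoʳ-≤ R (m≤m⊔n (suc x) er)) density ⟩
    R * M + B₂ * er              ≤⟨ +-monoʳ-≤ (R * M) (*-monoʳ-≤ B₂ (m≤n⊔m (suc x) er)) ⟩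
    R * M + B₂ * M               ≡⟨ *-distribʳ-+ M R B₂ ⟨
    (R + B₂) * M                 ≤⟨ *-monoˡ-≤ M (subst (R + B₂ ≤_) e₂ (red+blue≤esym L)) ⟩
    suc x * M                    ≡⟨ *-comm (suc x) M ⟩
    M * suc x                    ∎)
    where
    open ≤-Reasoning
    R B B₂ er M : ℕ
    R = cliques red 2 everywhere L
    B = cliques blue (suc (suc r)) everywhere L
    B₂ = cliques blue 2 everywhere L
    er = esym (suc (suc r)) (weights L)
    M = suc x ⊔ er
    density : B * suc x ≤ B₂ * er
    density = subst (λ e → B * e ≤ B₂ * er) e₂ (density-anti blue L everywhere (s≤s (s≤s z≤n)))

-- Blow-ups: weights become numbers of twins.

copiesOf : {V : Set} → List (V × ℕ) → List V
copiesOf []            = []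
copiesOf ((v , w) ∷ L) = replicate w v ++ copiesOf L

length-copiesOf : {V : Set} (L : List (V × ℕ)) → length (copiesOf L) ≡ sum (weights L)
length-copiesOf []            = refl
length-copiesOf ((v , w) ∷ L) = trans (length-++ (replicate w v))
  (cong₂ _+_ (length-replicate w) (length-copiesOf L))

unit : {V : Set} → V → V × ℕ
unit v = v , 1

module _ {V : Set} (a : V → V → Bool) (a-irrefl : ∀ v → a v v ≡ false) where

  cliques-skip : ∀ r w {p v} → p v ≡ false → ∀ L →
                 cliques a r p (map unit (replicate w v ++ L)) ≡ cliques a r p (map unit L)
  cliques-skip zero    w       pv L = refl
  cliques-skip (suc r) zero    pv L = refl
  cliques-skip (suc r) (suc w) pv L rewrite pv = trans (+-identityʳ _) (cliques-skip (suc r) w pv L)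

  -- Replacing a vertex of weight w by w pairwise nonadjacent twins.
  cliques-copiesOf : ∀ r p L → cliques a r p (map unit (copiesOf L)) ≡ cliques a r p L
  cliques-copiesOf zero    p L  = refl
  cliques-copiesOf (suc r) p [] = refl
  cliques-copiesOf (suc r) p ((v , w) ∷ L) = trans (twins w) (cong (_+ w * (if p v then C r q L else 0)) (cliques-copiesOf (suc r) p L))
    where
    C = cliques a
    q : V → Bool
    q u = p u ∧ a v u
    qv : q v ≡ false
    qv rewrite a-irrefl v = ∧-zeroʳ (p v)
    twins : ∀ w → C (suc r) p (map unit (replicate w v ++ copiesOf L)) ≡
                  C (suc r) p (map unit (copiesOf L)) + w * (if p v then C r q L else 0)
    twins zero    = sym (+-identityʳ _)
    twins (suc w) rewrite twins w | cliques-skip r w {q} qv (copiesOf L) | cliques-copiesOf r q L =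
      regroup (C (suc r) p (map unit (copiesOf L))) w (if p v then C r q L else 0)
      where
      regroup : ∀ a w c → a + w * c + (c + 0) ≡ a + (c + w * c)
      regroup = solve-∀

-- Finite subsets, their images and two-element sets.

enum : ∀ {n} (p : Subset n) → Fin ∣ p ∣ → Fin n
enum (outside ∷ p) i       = suc (enum p i)
enum (inside  ∷ p) zero    = zero
enum (inside  ∷ p) (suc i) = suc (enum p i)

enum-∈ : ∀ {n} (p : Subset n) i → enum p i ∈ p
enum-∈ (outside ∷ p) i       = there (enum-∈ p i)
enum-∈ (inside  ∷ p) zero    = here
enum-∈ (inside  ∷ p) (suc i) = there (enum-∈ p i)

enum-injective : ∀ {n} (p : Subset n) {i j} → enum p i ≡ enum p j → i ≡ j
enum-injective (outside ∷ p) eq = enum-injective p (suc-injective eq)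
enum-injective (inside  ∷ p) {zero}  {zero}  eq = refl
enum-injective (inside  ∷ p) {suc i} {suc j} eq = cong suc (enum-injective p (suc-injective eq))

enum-surjective : ∀ {n} (p : Subset n) {x} → x ∈ p → ∃[ i ] enum p i ≡ x
enum-surjective (outside ∷ p) (there x∈p) with enum-surjective p x∈p
... | i , refl = i , refl
enum-surjective (inside ∷ p) here = zero , refl
enum-surjective (inside ∷ p) (there x∈p) with enum-surjective p x∈p
... | i , refl = suc i , refl

-- Stated for a relation, so that it serves both for a map and for the inverse of an injection.
∣∣-mono : ∀ {m n} {p : Subset m} {q : Subset n} (R : Fin m → Fin n → Set) →
          (∀ {x} → x ∈ p → ∃[ y ] (y ∈ q × R x y)) → (∀ {x x′ y} → R x y → R x′ y → x ≡ x′) → ∣ p ∣ ≤ ∣ q ∣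
∣∣-mono {p = p} {q} R total inj = injective⇒≤ {f = f} λ {i} {j} eq → enum-injective p
  (inj (R-f i) (subst (λ k → R (enum p j) (enum q k)) (sym eq) (R-f j)))
  where
  choose : ∀ i → ∃[ k ] R (enum p i) (enum q k)
  choose i with total (enum-∈ p i)
  ... | y , y∈q , Rxy with enum-surjective q y∈q
  ...   | k , refl = k , Rxy
  f : Fin ∣ p ∣ → Fin ∣ q ∣
  f i = proj₁ (choose i)
  R-f : ∀ i → R (enum p i) (enum q (f i))
  R-f i = proj₂ (choose i)

∣image∣ : ∀ {m n} (φ : Fin m ↣ Fin n) p → ∣ image (to φ) p ∣ ≡ ∣ p ∣
∣image∣ φ p = ≤-antisym
  (∣∣-mono (λ y x → to φ x ≡ y) (λ y∈ → ∈-image⁻ (to φ) p y∈) (λ e e′ → trans (sym e) e′))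
  (∣∣-mono (λ x y → to φ x ≡ y) (λ {x} x∈ → to φ x , ∈-image⁺ (to φ) x∈ , refl) (λ e e′ → injective φ (trans e (sym e′))))

image-injective : ∀ {m n} (φ : Fin m ↣ Fin n) {p q} → image (to φ) p ≡ image (to φ) q → p ≡ q
image-injective φ {p} {q} eq = ⊆-antisym (half eq) (half (sym eq))
  where
  half : ∀ {p q} → image (to φ) p ≡ image (to φ) q → p ⊆ q
  half {p} {q} eq {x} x∈p with ∈-image⁻ (to φ) q (subst (to φ x ∈_) eq (∈-image⁺ (to φ) x∈p))
  ... | y , y∈q , φy≡φx = subst (_∈ q) (injective φ φy≡φx) y∈q

⊆∧∣∣≡⇒≡ : ∀ {n} {p q : Subset n} → p ⊆ q → ∣ p ∣ ≡ ∣ q ∣ → p ≡ q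
⊆∧∣∣≡⇒≡ {p = []}          {[]}          p⊆q eq = refl
⊆∧∣∣≡⇒≡ {p = inside ∷ p}  {inside ∷ q}  p⊆q eq = cong (inside ∷_) (⊆∧∣∣≡⇒≡ (drop-∷-⊆ p⊆q) (suc-injectiveℕ eq))
⊆∧∣∣≡⇒≡ {p = outside ∷ p} {outside ∷ q} p⊆q eq = cong (outside ∷_) (⊆∧∣∣≡⇒≡ (drop-∷-⊆ p⊆q) eq)
⊆∧∣∣≡⇒≡ {p = inside ∷ p}  {outside ∷ q} p⊆q eq with () ← p⊆q here
⊆∧∣∣≡⇒≡ {p = outside ∷ p} {inside ∷ q}  p⊆q eq =
  ⊥-elim (<-irrefl eq (s≤s (∣∣-mono _≡_ (λ {x} x∈p → x , drop-∷-⊆ p⊆q x∈p , refl) (λ { refl refl → refl }))))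

∣p∣≡0⇒p≡⊥ : ∀ {n} (p : Subset n) → ∣ p ∣ ≡ 0 → p ≡ ⊥
∣p∣≡0⇒p≡⊥ {n} p eq = sym (⊆∧∣∣≡⇒≡ (λ x∈⊥ → ⊥-elim (∉⊥ x∈⊥)) (trans (∣⊥∣≡0 n) (sym eq)))

pair : ∀ {n} {u v : Fin n} → u ≢ v → Fin 2 ↣ Fin n
pair {u = u} {v} u≢v = mk↣ {to = f} inj
  where
  f : Fin 2 → Fin _
  f zero    = u
  f (suc _) = v
  inj : ∀ {i j} → f i ≡ f j → i ≡ j
  inj {zero}     {zero}     _  = refl
  inj {zero}     {suc _}    eq = ⊥-elim (u≢v eq)
  inj {suc _}    {zero}     eq = ⊥-elim (u≢v (sym eq))
  inj {suc zero} {suc zero} _  = refl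

-- The set {u, v}, written as an image so that the general facts on `image` give its size and
-- elements.
⟪_⟫ : ∀ {n} {u v : Fin n} → u ≢ v → Subset n
⟪ u≢v ⟫ = image (to (pair u≢v)) ⊤

∣⟪⟫∣ : ∀ {n} {u v : Fin n} (u≢v : u ≢ v) → ∣ ⟪ u≢v ⟫ ∣ ≡ 2
∣⟪⟫∣ u≢v = ∣image∣ (pair u≢v) ⊤

⟪⟫-∈ˡ : ∀ {n} {u v : Fin n} (u≢v : u ≢ v) → u ∈ ⟪ u≢v ⟫
⟪⟫-∈ˡ u≢v = ∈-image⁺ (to (pair u≢v)) {x = zero} ∈⊤

⟪⟫-∈ʳ : ∀ {n} {u v : Fin n} (u≢v : u ≢ v) → v ∈ ⟪ u≢v ⟫
⟪⟫-∈ʳ u≢v = ∈-image⁺ (to (pair u≢v)) {x = suc zero} ∈⊤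

⟪⟫-⊆ : ∀ {n} {u v : Fin n} (u≢v : u ≢ v) {p} → u ∈ p → v ∈ p → ⟪ u≢v ⟫ ⊆ p
⟪⟫-⊆ u≢v u∈p v∈p x∈ with ∈-image⁻ (to (pair u≢v)) ⊤ x∈
... | zero  , _ , refl = u∈p
... | suc _ , _ , refl = v∈p

⟪⟫-unique : ∀ {n} {u v : Fin n} (u≢v : u ≢ v) {p} → ∣ p ∣ ≡ 2 → u ∈ p → v ∈ p → p ≡ ⟪ u≢v ⟫
⟪⟫-unique u≢v ∣p∣ u∈p v∈p = sym (⊆∧∣∣≡⇒≡ (⟪⟫-⊆ u≢v u∈p v∈p) (trans (∣⟪⟫∣ u≢v) (sym ∣p∣)))

two-elements : ∀ {n} (p : Subset n) → ∣ p ∣ ≡ 2 → ∃[ u ] ∃[ v ] (u ≢ v × u ∈ p × v ∈ p)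
two-elements p eq = go (enum p) (enum-injective p) (enum-∈ p) eq
  where
  go : ∀ {m} (f : Fin m → Fin _) → (∀ {i j} → f i ≡ f j → i ≡ j) → (∀ i → f i ∈ p) → m ≡ 2 →
       ∃[ u ] ∃[ v ] (u ≢ v × u ∈ p × v ∈ p)
  go f inj ∈p refl = f zero , f (suc zero) , (λ e → 0≢1+n (inj e)) , ∈p zero , ∈p (suc zero)

unique⇒length≤-⊆ : {A : Set} {xs ys : List A} → Unique xs → (∀ {x} → x ∈ˡ xs → x ∈ˡ ys) → length xs ≤ length ys
unique⇒length≤-⊆ {xs = xs} {ys} u xs⊆ys = injective⇒≤ λ {i} {j} eq → lookup-injective u
  (trans (lookup-index (at i)) (trans (cong (lookup ys) eq) (sym (lookup-index (at j)))))
  where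
  at : ∀ i → lookup xs i ∈ˡ ys
  at i = xs⊆ys (∈-lookup i)

-- Cliques as vertex sets.

module _ {V : Set} (a : V → V → Bool) where

  -- `S` consists of positions, and `g` may give several positions the same label, as happens for
  -- twins.
  record IsClique {n} (r : ℕ) (p : V → Bool) (g : Fin n → V) (S : Subset n) : Set where
    constructor isClique
    field
      card     : ∣ S ∣ ≡ r
      allowed  : ∀ {x} → x ∈ S → p (g x) ≡ true
      adjacent : ∀ {x y} → x ∈ S → y ∈ S → x ≢ y → a (g x) (g y) ≡ true

  -- The recursion mirrors that of `cliques` at unit weights, so its length is the clique count.
  cliqueSets : ∀ {n} → ℕ → (V → Bool) → (Fin n → V) → List (Subset n)
  cliqueSets         zero    p g = ⊥ ∷ []
  cliqueSets {zero}  (suc r) p g = []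
  cliqueSets {suc n} (suc r) p g = map (outside ∷_) (cliqueSets (suc r) p (g ∘ suc)) ++
    (if p (g zero) then map (inside ∷_) (cliqueSets r (λ u → p u ∧ a (g zero) u) (g ∘ suc)) else [])

  length-cliqueSets : ∀ {n} r p (g : Fin n → V) →
                      length (cliqueSets r p g) ≡ cliques a r p (map unit (tabulate g))
  length-cliqueSets         zero    p g = refl
  length-cliqueSets {zero}  (suc r) p g = refl
  length-cliqueSets {suc n} (suc r) p g = trans (length-++ (map (outside ∷_) (cliqueSets (suc r) p (g ∘ suc)))) (cong₂ _+_
    (trans (length-map (outside ∷_) (cliqueSets (suc r) p (g ∘ suc))) (length-cliqueSets (suc r) p (g ∘ suc)))
    (link (p (g zero))))
    where
    q : V → Bool
    q u = p u ∧ a (g zero) u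
    link : ∀ c → length (if c then map (inside ∷_) (cliqueSets r q (g ∘ suc)) else []) ≡
                 1 * (if c then cliques a r q (map unit (tabulate (g ∘ suc))) else 0)
    link true  = trans (length-map (inside ∷_) (cliqueSets r q (g ∘ suc)))
      (trans (length-cliqueSets r q (g ∘ suc)) (sym (+-identityʳ _)))
    link false = refl

  cliqueSets-unique : ∀ {n} r p (g : Fin n → V) → Unique (cliqueSets r p g)
  cliqueSets-unique         zero    p g = [] ∷ []
  cliqueSets-unique {zero}  (suc r) p g = []
  cliqueSets-unique {suc n} (suc r) p g with p (g zero)
  ... | true  = Unique.++⁺ (Unique.map⁺ ∷-injectiveʳ (cliqueSets-unique (suc r) p (g ∘ suc)))
                  (Unique.map⁺ ∷-injectiveʳ (cliqueSets-unique r _ (g ∘ suc))) disjoint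
    where
    disjoint : ∀ {S} {xs ys : List (Subset n)} → ¬ (S ∈ˡ map (outside ∷_) xs × S ∈ˡ map (inside ∷_) ys)
    disjoint (x , y) with ∈-map⁻ _ x | ∈-map⁻ _ y
    ... | _ , _ , refl | _ , _ , ()
  ... | false = Unique.++⁺ (Unique.map⁺ ∷-injectiveʳ (cliqueSets-unique (suc r) p (g ∘ suc))) [] λ ()

  cliqueSets-sound : (∀ u v → a u v ≡ a v u) → ∀ {n} r p (g : Fin n → V) {S} →
                     S ∈ˡ cliqueSets r p g → IsClique r p g S
  cliqueSets-sound a-sym {n} zero p g (here refl) =
    isClique (∣⊥∣≡0 n) (λ x∈ → ⊥-elim (∉⊥ x∈)) (λ x∈ → ⊥-elim (∉⊥ x∈))
  cliqueSets-sound a-sym {suc n} (suc r) p g S∈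
    with ∈-++⁻ (map (outside ∷_) (cliqueSets (suc r) p (g ∘ suc))) S∈
  ... | inj₁ S∈′ with ∈-map⁻ (outside ∷_) S∈′
  ...   | S′ , S′∈ , refl = isClique (card c)
            (λ { (there x∈) → allowed c x∈ })
            (λ { (there x∈) (there y∈) x≢y → adjacent c x∈ y∈ (λ e → x≢y (cong suc e)) })
    where
    open IsClique
    c : IsClique (suc r) p (g ∘ suc) S′
    c = cliqueSets-sound a-sym (suc r) p (g ∘ suc) S′∈
  cliqueSets-sound a-sym {suc n} (suc r) p g S∈ | inj₂ S∈′ with p (g zero) in pg
  ... | true with ∈-map⁻ (inside ∷_) S∈′
  ...   | S′ , S′∈ , refl = isClique (cong suc (card c))
            (λ { here → pg ; (there x∈) → proj₁ (∧-split (allowed c x∈)) })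
            (λ { here here x≢y → ⊥-elim (x≢y refl)
               ; here (there y∈) _ → proj₂ (∧-split (allowed c y∈))
               ; (there x∈) here _ → trans (a-sym _ _) (proj₂ (∧-split (allowed c x∈)))
               ; (there x∈) (there y∈) x≢y → adjacent c x∈ y∈ (λ e → x≢y (cong suc e)) })
    where
    open IsClique
    c : IsClique r (λ u → p u ∧ a (g zero) u) (g ∘ suc) S′
    c = cliqueSets-sound a-sym r _ (g ∘ suc) S′∈
    ∧-split : ∀ {x y} → x ∧ y ≡ true → x ≡ true × y ≡ true
    ∧-split {true} {true} refl = refl , refl

  cliqueSets-complete : ∀ {n} r p (g : Fin n → V) {S} → IsClique r p g S → S ∈ˡ cliqueSets r p g
  cliqueSets-complete zero p g {S} c = here (∣p∣≡0⇒p≡⊥ S (IsClique.card c))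
  cliqueSets-complete {suc n} (suc r) p g {outside ∷ S} c = ∈-++⁺ˡ (∈-map⁺ (outside ∷_)
    (cliqueSets-complete (suc r) p (g ∘ suc) (isClique card (λ x∈ → allowed (there x∈))
      (λ x∈ y∈ x≢y → adjacent (there x∈) (there y∈) (λ e → x≢y (suc-injective e))))))
    where open IsClique c
  cliqueSets-complete {suc n} (suc r) p g {inside ∷ S} c rewrite IsClique.allowed c here =
    ∈-++⁺ʳ (map (outside ∷_) (cliqueSets (suc r) p (g ∘ suc))) (∈-map⁺ (inside ∷_)
    (cliqueSets-complete r _ (g ∘ suc) (isClique (suc-injectiveℕ card)
      (λ x∈ → cong₂ _∧_ (allowed (there x∈)) (adjacent here (there x∈) λ ()))
      (λ x∈ y∈ x≢y → adjacent (there x∈) (there y∈) (λ e → x≢y (suc-injective e))))))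
    where open IsClique c

-- Clique counts realized in graphs without K_k.

-- The map `φ` is arbitrary, so that a clique in a blow-up can be pushed forward to its labels; if
-- `a` is irreflexive, adjacency makes `φ` injective.
CliqueFree : {V : Set} → (V → V → Bool) → ℕ → Set
CliqueFree {V} a k = (φ : Fin k → V) → ¬ (∀ {x y} → x ≢ y → a (φ x) (φ y) ≡ true)

K-complete : ∀ {k} {p : Subset k} → ∣ p ∣ ≡ 2 → p ∈ˡ edges (K k)
K-complete {p = p} eq = ∈-filter⁺ (λ e → ∣ e ∣ ≟ 2) (subsets-complete p) eq

module Realization {V : Set} (a : V → V → Bool) (a-sym : ∀ u v → a u v ≡ a v u) {n : ℕ} (g : Fin n → V) where

  graph : Graph n
  graph = record
    { edges   = cliqueSets a 2 everywhere g
    ; unique  = cliqueSets-unique a 2 everywhere g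
    ; uniform = All.tabulate λ e∈ → IsClique.card (cliqueSets-sound a a-sym 2 everywhere g e∈)
    }

  graph-free : ∀ {k} → CliqueFree a k → Free (K k) graph
  graph-free {k} free (φ , f , emb) = free (g ∘ to φ) adjacent
    where
    adjacent : ∀ {x y} → x ≢ y → a (g (to φ x)) (g (to φ y)) ≡ true
    adjacent {x} {y} x≢y = IsClique.adjacent (cliqueSets-sound a a-sym 2 everywhere g e∈)
      (∈-image⁺ (to φ) (⟪⟫-∈ˡ x≢y)) (∈-image⁺ (to φ) (⟪⟫-∈ʳ x≢y)) (λ e → x≢y (injective φ e))
      where
      xy∈ : ⟪ x≢y ⟫ ∈ˡ edges (K k)
      xy∈ = K-complete (∣⟪⟫∣ x≢y)
      e∈ : image (to φ) ⟪ x≢y ⟫ ∈ˡ edges graph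
      e∈ = subst (λ p → image (to φ) p ∈ˡ edges graph) (sym (lookup-index xy∈))
        (subst (_∈ˡ edges graph) (sym (emb (index xy∈))) (∈-lookup (to f (index xy∈))))

  -- `enum S` sends every edge of the complete graph to an edge of `graph` because `S` is a clique;
  -- `T` collects these edges.
  copy : ∀ {r S} → S ∈ˡ cliqueSets a r everywhere g → ∃[ T ] IsCopy (K r) graph (S , T)
  copy {r} {S} S∈ with cliqueSets-sound a a-sym r everywhere g S∈
  ... | isClique refl _ adjacent = image (to f) ⊤ , φ , f , lookup-edge , image≡S , refl
    where
    φ : Fin ∣ S ∣ ↣ Fin n
    φ = mk↣ {to = enum S} (enum-injective S)
    edge∈ : ∀ i → image (enum S) (K ∣ S ∣ ‼ i) ∈ˡ edges graph
    edge∈ i = cliqueSets-complete a 2 everywhere g (isClique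
      (trans (∣image∣ φ _) (All.lookup (uniform (K ∣ S ∣)) (∈-lookup i)))
      (λ _ → refl)
      λ x∈ y∈ x≢y → adjacent (⊆S i x∈) (⊆S i y∈) x≢y)
      where
      ⊆S : ∀ i {x} → x ∈ image (enum S) (K ∣ S ∣ ‼ i) → x ∈ S
      ⊆S i x∈ with ∈-image⁻ (enum S) (K ∣ S ∣ ‼ i) x∈
      ... | j , _ , refl = enum-∈ S j
    lookup-edge : ∀ i → image (enum S) (K ∣ S ∣ ‼ i) ≡ graph ‼ index (edge∈ i)
    lookup-edge i = lookup-index (edge∈ i)
    f : E (K ∣ S ∣) ↣ E graph
    f = mk↣ {to = λ i → index (edge∈ i)} λ {i} {j} eq → lookup-injective (unique (K ∣ S ∣))
      (image-injective φ (trans (lookup-edge i) (trans (cong (graph ‼_) eq) (sym (lookup-edge j)))))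
    image≡S : image (enum S) ⊤ ≡ S
    image≡S = ⊆-antisym sub sup
      where
      sub : image (enum S) ⊤ ⊆ S
      sub x∈ with ∈-image⁻ (enum S) ⊤ x∈
      ... | j , _ , refl = enum-∈ S j
      sup : S ⊆ image (enum S) ⊤
      sup x∈ with enum-surjective S x∈
      ... | j , refl = ∈-image⁺ (enum S) {x = j} ∈⊤

  -- A copy is a vertex set with an edge set, and distinct cliques already differ in the vertex set,
  -- so it suffices to compare first components.
  cliques≤copies : ∀ r → cliques a r everywhere (map unit (tabulate g)) ≤ copies (K r) graph
  cliques≤copies r = begin
    cliques a r everywhere (map unit (tabulate g)) ≡⟨ length-cliqueSets a r everywhere g ⟨
    length (cliqueSets a r everywhere g)           ≤⟨ unique⇒length≤-⊆ (cliqueSets-unique a r everywhere g) embed ⟩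
    length (map proj₁ copyList)                    ≡⟨ length-map proj₁ copyList ⟩
    copies (K r) graph                             ∎
    where
    open ≤-Reasoning
    copyList : List (Subset n × Subset (size graph))
    copyList = filter (isCopy? (K r) graph) (cartesianProduct (subsets n) (subsets (size graph)))
    embed : ∀ {S} → S ∈ˡ cliqueSets a r everywhere g → S ∈ˡ map proj₁ copyList
    embed S∈ with copy S∈
    ... | T , isC = ∈-map⁺ proj₁ (∈-filter⁺ (isCopy? (K r) graph)
      (∈-cartesianProduct⁺ (subsets-complete _) (subsets-complete T)) isC)

  cliques≤exCopies : ∀ {k} r → CliqueFree a k →
                     cliques a r everywhere (map unit (tabulate g)) ≤ exCopies n (K r) (K k)
  cliques≤exCopies {k} r free = ≤-trans (cliques≤copies r)
    (proj₁ (exCopies-isMaximum n (K r) (K k)) graph (graph-free free))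

  cliques≤ex : ∀ {k} → CliqueFree a k → cliques a 2 everywhere (map unit (tabulate g)) ≤ ex n (K k)
  cliques≤ex {k} free = ≤-trans (≤-reflexive (sym (length-cliqueSets a 2 everywhere g)))
    (proj₁ (ex-isMaximum n (K k)) graph (graph-free free))

-- Matchings, augmenting paths and the König-type decomposition.

unique-↭ : {A : Set} {xs ys : List A} → xs ↭ ys → Unique xs → Unique ys
unique-↭ {A} π = Unique-resp-↭ (setoid A) (↭⇒↭ₛ π)

unique-++⁻ˡ : {A : Set} (xs : List A) {ys : List A} → Unique (xs ++ ys) → Unique xs
unique-++⁻ˡ []       _        = []
unique-++⁻ˡ (x ∷ xs) (x∉ ∷ u) = All.++⁻ˡ xs x∉ ∷ unique-++⁻ˡ xs u

unique⇒functional : {A B : Set} {M : List (A × B)} → Unique (map proj₁ M) →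
                    ∀ {a b b′} → (a , b) ∈ˡ M → (a , b′) ∈ˡ M → b ≡ b′
unique⇒functional _        (here refl) (here refl) = refl
unique⇒functional (a∉ ∷ _) (here refl) (there b′∈) = ⊥-elim (All.lookup a∉ (∈-map⁺ proj₁ b′∈) refl)
unique⇒functional (a∉ ∷ _) (there b∈)  (here refl) = ⊥-elim (All.lookup a∉ (∈-map⁺ proj₁ b∈) refl)
unique⇒functional (_ ∷ u)  (there b∈)  (there b′∈) = unique⇒functional u b∈ b′∈

∈⇒↭ : {A : Set} {x : A} {xs : List A} → x ∈ˡ xs → ∃[ ys ] xs ↭ x ∷ ys
∈⇒↭ {xs = x ∷ xs} (here refl) = xs , ↭-refl
∈⇒↭ {xs = y ∷ xs} (there x∈) with ∈⇒↭ x∈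
... | ys , π = y ∷ ys , ↭-trans (↭.prep y π) (↭.shift _ (y ∷ []) ys)

module Matchings {A B : Set} (nbr : A → List B) where

  lefts : List (A × B) → List A
  lefts = map proj₁

  rights : List (A × B) → List B
  rights = map proj₂

  Edge : A × B → Set
  Edge (a , b) = b ∈ˡ nbr a

  -- `X` holds the right vertices that are off limits. Distinctness of the left vertices comes from
  -- elsewhere: `split` in `König` makes them part of a permutation of the given list.
  record Matching (X : List B) (M : List (A × B)) : Set where
    constructor matching
    field
      distinct : Unique (rights M)
      isEdge   : All Edge M
      avoids   : All (_∉ˡ X) (rights M)

  open Matching

  Closed : List B → List A → Set
  Closed X = All (λ a → All (_∈ˡ X) (nbr a))

  Closed-⊆ : ∀ {X Y as} → (∀ {b} → b ∈ˡ X → b ∈ˡ Y) → Closed X as → Closed Y as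
  Closed-⊆ X⊆Y = All.map (All.map X⊆Y)

  matching-↭ : ∀ {X M M′} → M ↭ M′ → Matching X M → Matching X M′
  matching-↭ π (matching u e v) = matching (unique-↭ (↭.map⁺ proj₂ π) u) (↭.All-resp-↭ π e) (↭.All-resp-↭ (↭.map⁺ proj₂ π) v)

  matching-tail : ∀ {X a b M} → Matching X ((a , b) ∷ M) → Matching (b ∷ X) M
  matching-tail (matching (b∉ ∷ u) (_ ∷ e) (_ ∷ v)) = matching u e
    (All.zipWith (λ { (b≢ , ∉X) (here eq) → b≢ (sym eq) ; (b≢ , ∉X) (there ∈X) → ∉X ∈X }) (b∉ , v))

  matching-cons : ∀ {X a b M} → b ∈ˡ nbr a → b ∉ˡ X → Matching (b ∷ X) M → Matching X ((a , b) ∷ M)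
  matching-cons b∈ b∉X (matching u e v) = matching
    (All.map (λ ∉bX eq → ∉bX (here (sym eq))) v ∷ u) (b∈ ∷ e) (b∉X ∷ All.map (λ ∉bX ∈X → ∉bX (there ∈X)) v)

  -- The right vertices of `N` become forbidden for the rest, so the rest can be rematched and
  -- joined to `N` again by `matching-++⁺`.
  matching-++⁻ : ∀ {X} N {M} → Matching X (N ++ M) → Matching X N × Matching (X ++ rights N) M
  matching-++⁻ {X} [] m = matching [] [] [] , subst (λ Y → Matching Y _) (sym (++-identityʳ X)) m
  matching-++⁻ {X} ((a , b) ∷ N) {M} m with matching-++⁻ N (matching-tail m) | m
  ... | mN , mM | matching _ (e ∷ _) (b∉ ∷ _) = matching-cons e b∉ mN ,
    matching (distinct mM) (isEdge mM) (All.map (λ b∉ b∈ → b∉ (move b∈)) (avoids mM))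
    where
    move : ∀ {x} → x ∈ˡ X ++ b ∷ rights N → x ∈ˡ b ∷ X ++ rights N
    move = ↭.∈-resp-↭ (↭.shift b X (rights N))

  matching-++⁺ : ∀ {X} N {M} → Matching X N → Matching (X ++ rights N) M → Matching X (N ++ M)
  matching-++⁺ {X} [] _ m = subst (λ Y → Matching Y _) (++-identityʳ X) m
  matching-++⁺ {X} ((a , b) ∷ N) {M} mN@(matching _ (e ∷ _) (b∉ ∷ _)) m = matching-cons e b∉
    (matching-++⁺ N (matching-tail mN)
      (matching (distinct m) (isEdge m) (All.map (λ b∉ b∈ → b∉ (move b∈)) (avoids m))))
    where
    move : ∀ {x} → x ∈ˡ b ∷ X ++ rights N → x ∈ˡ X ++ b ∷ rights N
    move = ↭.∈-resp-↭ (↭-sym (↭.shift b X (rights N)))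

  Augmented : List B → List (A × B) → A → Set
  Augmented X M a = ∃[ M′ ] (lefts M′ ↭ a ∷ lefts M × Matching X M′)

  -- A Hall-type obstruction: outside `X`, the left vertices `a ∷ lefts N` see only `rights N`,
  -- which is one vertex too few.
  Stuck : List B → List (A × B) → A → Set
  Stuck X M a = ∃[ N ] ∃[ M′ ] (M ↭ N ++ M′ × Closed (X ++ rights N) (a ∷ lefts N))

  -- The vertices lefts M₁ ++ F and rights M₁ are those reachable by alternating paths from F.
  record König (as : List A) : Set where
    constructor könig
    field
      M₁ M₂  : List (A × B)
      F      : List A
      split  : as ↭ (lefts M₁ ++ F) ++ lefts M₂
      match₁ : Matching [] M₁
      match₂ : Matching (rights M₁) M₂
      closed : Closed (rights M₁) (lefts M₁ ++ F)

  module _ (_≟ᴮ_ : DecidableEquality B) where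

    open import Data.List.Membership.DecPropositional _≟ᴮ_ using () renaming (_∈?_ to _∈ˡ?_)

    newNeighbour : ∀ X (bs : List B) → All (_∈ˡ X) bs ⊎ ∃[ b ] (b ∈ˡ bs × b ∉ˡ X)
    newNeighbour X [] = inj₁ []
    newNeighbour X (b ∷ bs) with _∈ˡ?_ b X | newNeighbour X bs
    ... | no b∉X  | _                    = inj₂ (b , here refl , b∉X)
    ... | yes b∈X | inj₁ sub             = inj₁ (b∈X ∷ sub)
    ... | yes _   | inj₂ (c , c∈ , c∉X) = inj₂ (c , there c∈ , c∉X)

    -- Depth-first search for an augmenting path: a takes a vertex b of a′ if a′
    -- can be matched elsewhere; otherwise the set that blocks a′ joins X.
    augment : ∀ k X M a → length M ≤ k → Matching X M → Augmented X M a ⊎ Stuck X M a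
    augment k X M a len m with newNeighbour X (nbr a)
    ... | inj₁ sub = inj₂ ([] , M , ↭-refl , All.map ∈-++⁺ˡ sub ∷ [])
    ... | inj₂ (b , b∈a , b∉X) with _∈ˡ?_ b (rights M)
    ... | no b∉M = inj₁ ((a , b) ∷ M , ↭-refl , matching
      (All.¬Any⇒All¬ (rights M) b∉M ∷ distinct m) (b∈a ∷ isEdge m) (b∉X ∷ avoids m))
    ... | yes b∈M with ∈-map⁻ proj₂ b∈M
    ... | (a′ , _) , ab∈ , refl with ∈⇒↭ ab∈
    -- Removing the pair of `b` makes the matching smaller, so the bound `k` is a successor and can
    -- decrease.
    ... | M₀ , π with k | ≤-trans (≤-reflexive (sym (↭.↭-length π))) len
    ... | suc k | s≤s len₀ with augment k (b ∷ X) M₀ a′ len₀ (matching-tail (matching-↭ π m))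
    ... | inj₁ (M′ , ρ , m′) = inj₁ ((a , b) ∷ M′ , ↭.prep a (↭-trans ρ (↭-sym (↭.map⁺ proj₁ π))) , matching-cons b∈a b∉X m′)
    ... | inj₂ (N₀ , M′ , ρ , closed₀) = continue (augment k (X ++ rights N) M′ a len′ (proj₂ mNM))
      where
      N : List (A × B)
      N = (a′ , b) ∷ N₀
      σ : M ↭ N ++ M′
      σ = ↭-trans π (↭.prep _ ρ)
      mNM : Matching X N × Matching (X ++ rights N) M′
      mNM = matching-++⁻ N (matching-↭ σ m)
      closedN : Closed (X ++ rights N) (lefts N)
      closedN = Closed-⊆ (↭.∈-resp-↭ (↭-sym (↭.shift b X (rights N₀)))) closed₀
      len′ : length M′ ≤ k
      len′ = ≤-trans (≤-trans (m≤n+m _ (length N₀)) (≤-reflexive (trans (sym (length-++ N₀)) (sym (↭.↭-length ρ))))) len₀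
      continue : Augmented (X ++ rights N) M′ a ⊎ Stuck (X ++ rights N) M′ a → Augmented X M a ⊎ Stuck X M a
      continue (inj₁ (M″ , τ , m″)) = inj₁ (N ++ M″ , perm , matching-++⁺ N (proj₁ mNM) m″)
        where
        open PermutationReasoning
        perm : lefts (N ++ M″) ↭ a ∷ lefts M
        perm = begin
          lefts (N ++ M″)           ≡⟨ map-++ proj₁ N M″ ⟩
          lefts N ++ lefts M″       ↭⟨ ↭.++⁺ˡ (lefts N) τ ⟩
          lefts N ++ a ∷ lefts M′   ↭⟨ ↭.shift a (lefts N) (lefts M′) ⟩
          a ∷ lefts N ++ lefts M′   ≡⟨ cong (a ∷_) (map-++ proj₁ N M′) ⟨
          a ∷ lefts (N ++ M′)       ↭⟨ ↭.prep a (↭.map⁺ proj₁ (↭-sym σ)) ⟩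
          a ∷ lefts M               ∎
      continue (inj₂ (N′ , M″ , τ , a-closed ∷ closed′)) = inj₂ (N ++ N′ , M″ , perm ,
        subst (λ Y → Closed Y (a ∷ lefts (N ++ N′))) rights-assoc a-closed′)
        where
        perm : M ↭ (N ++ N′) ++ M″
        perm = ↭-trans σ (↭-trans (↭.++⁺ˡ N τ) (↭-reflexive (sym (++-assoc N N′ M″))))
        rights-assoc : (X ++ rights N) ++ rights N′ ≡ X ++ rights (N ++ N′)
        rights-assoc = trans (++-assoc X (rights N) (rights N′)) (cong (X ++_) (sym (map-++ proj₂ N N′)))
        a-closed′ : Closed ((X ++ rights N) ++ rights N′) (a ∷ lefts (N ++ N′))
        a-closed′ = a-closed ∷ subst (Closed _) (sym (map-++ proj₁ N N′))
          (All.++⁺ (Closed-⊆ ∈-++⁺ˡ closedN) closed′)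

    -- Left vertices are inserted one at a time. A successful augmentation changes only `M₂`;
    -- otherwise the obstruction `N` moves from `M₂` to the closed side and `a` joins the unmatched
    -- vertices `F`.
    könig-exists : ∀ as → König as
    könig-exists [] = könig [] [] [] ↭-refl (matching [] [] []) (matching [] [] []) []
    könig-exists (a ∷ as) with könig-exists as
    ... | könig M₁ M₂ F split m₁ m₂ closed with augment (length M₂) (rights M₁) M₂ a (≤-reflexive refl) m₂
    ... | inj₁ (M′ , π , m′) = könig M₁ M′ F perm m₁ m′ closed
      where
      perm : a ∷ as ↭ (lefts M₁ ++ F) ++ lefts M′
      perm = ↭-trans (↭.prep a split) (↭-trans (↭-sym (↭.shift a (lefts M₁ ++ F) (lefts M₂))) (↭.++⁺ˡ (lefts M₁ ++ F) (↭-sym π)))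
    ... | inj₂ (N , M′ , π , a-closed ∷ N-closed) = könig (M₁ ++ N) M′ (a ∷ F) perm (matching-++⁺ M₁ m₁ (proj₁ mm))
        (subst (λ Y → Matching Y M′) (sym rights-++) (proj₂ mm))
        (subst (λ Y → Closed Y (lefts (M₁ ++ N) ++ a ∷ F)) (sym rights-++) closed′)
      where
      rights-++ : rights (M₁ ++ N) ≡ rights M₁ ++ rights N
      rights-++ = map-++ proj₂ M₁ N
      mm : Matching (rights M₁) N × Matching (rights M₁ ++ rights N) M′
      mm = matching-++⁻ N (matching-↭ π m₂)
      old : Closed (rights M₁ ++ rights N) (lefts M₁ ++ F)
      old = Closed-⊆ ∈-++⁺ˡ closed
      closed′ : Closed (rights M₁ ++ rights N) (lefts (M₁ ++ N) ++ a ∷ F)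
      closed′ = All.++⁺ (subst (Closed _) (sym (map-++ proj₁ M₁ N)) (All.++⁺ (All.++⁻ˡ (lefts M₁) old) N-closed))
        (a-closed ∷ All.++⁻ʳ (lefts M₁) old)
      open PermutationReasoning
      perm : a ∷ as ↭ (lefts (M₁ ++ N) ++ a ∷ F) ++ lefts M′
      perm = begin
        a ∷ as                                          ↭⟨ ↭.prep a split ⟩
        a ∷ (lefts M₁ ++ F) ++ lefts M₂                 ↭⟨ ↭.prep a (↭.++⁺ˡ (lefts M₁ ++ F) (↭.map⁺ proj₁ π)) ⟩
        a ∷ (lefts M₁ ++ F) ++ lefts (N ++ M′)          ≡⟨ cong (λ z → a ∷ (lefts M₁ ++ F) ++ z) (map-++ proj₁ N M′) ⟩
        a ∷ (lefts M₁ ++ F) ++ lefts N ++ lefts M′      ≡⟨ cong (a ∷_) (++-assoc (lefts M₁ ++ F) (lefts N) (lefts M′)) ⟨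
        (a ∷ ((lefts M₁ ++ F) ++ lefts N)) ++ lefts M′  ↭⟨ ↭.++⁺ʳ (lefts M′) inner ⟩
        (lefts (M₁ ++ N) ++ a ∷ F) ++ lefts M′          ∎
        where
        inner : a ∷ ((lefts M₁ ++ F) ++ lefts N) ↭ lefts (M₁ ++ N) ++ a ∷ F
        inner = begin
          a ∷ ((lefts M₁ ++ F) ++ lefts N)   ≡⟨ cong (a ∷_) (++-assoc (lefts M₁) F (lefts N)) ⟩
          a ∷ lefts M₁ ++ F ++ lefts N       ↭⟨ ↭.prep a (↭.++⁺ˡ (lefts M₁) (↭.++-comm F (lefts N))) ⟩
          a ∷ lefts M₁ ++ lefts N ++ F       ≡⟨ cong (a ∷_) (++-assoc (lefts M₁) (lefts N) F) ⟨
          a ∷ (lefts M₁ ++ lefts N) ++ F     ↭⟨ ↭.shift a (lefts M₁ ++ lefts N) F ⟨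
          (lefts M₁ ++ lefts N) ++ a ∷ F     ≡⟨ cong (_++ a ∷ F) (map-++ proj₁ M₁ N) ⟨
          lefts (M₁ ++ N) ++ a ∷ F           ∎

-- From pairwise adjacent weighted vertices to extremal numbers.

-- The blow-up of `L` is complete multipartite with the weights as part sizes. It is K_k-free
-- because its labels are, and it has e_2 edges and at least e_r copies of K_r.
esym-realized : {V : Set} (a : V → V → Bool) → (∀ u v → a u v ≡ a v u) → (∀ v → a v v ≡ false) →
                ∀ {k} → CliqueFree a k → ∀ {n} r L → length (copiesOf L) ≡ n →
                AllPairs (λ x y → a (proj₁ x) (proj₁ y) ≡ true) L →
                esym 2 (weights L) ⊔ esym r (weights L) ≤ ex n (K k) ⊔ exCopies n (K r) (K k)
esym-realized a a-sym a-irrefl free r L refl pairwise = ⊔-mono-≤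
  (≤-trans (≤-reflexive (sym (realized 2))) (cliques≤ex free))
  (≤-trans (≤-reflexive (sym (realized r))) (cliques≤exCopies r free))
  where
  open Realization a a-sym (lookup (copiesOf L))
  realized : ∀ s → cliques a s everywhere (map unit (tabulate (lookup (copiesOf L)))) ≡ esym s (weights L)
  realized s = trans (cong (cliques a s everywhere ∘ map unit) (tabulate-lookup (copiesOf L)))
    (trans (cliques-copiesOf a a-irrefl s everywhere L)
      (cliques-pairwise a s L (All.tabulate λ _ → refl) pairwise))

-- Graphs given by lists of vertex pairs.

Joins : Fin n → Fin n → Subset n → Set
Joins u v e = u ≢ v × u ∈ e × v ∈ e

joined? : (es : List (Subset n)) (u v : Fin n) → Dec (Any (Joins u v) es)
joined? es u v = any? (λ e → ¬? (u ≟ᶠ v) ×-dec (u ∈? e) ×-dec (v ∈? e)) es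

joined : List (Subset n) → Fin n → Fin n → Bool
joined es u v = does (joined? es u v)

joined⁺ : ∀ {es} {u v : Fin n} → Any (Joins u v) es → joined es u v ≡ true
joined⁺ {es = es} {u} {v} = dec-true (joined? es u v)

joined⁻ : ∀ es {u v : Fin n} → joined es u v ≡ true → Any (Joins u v) es
joined⁻ es {u} {v} eq with joined? es u v
... | yes j = j

joined-sym : ∀ es (u v : Fin n) → joined es u v ≡ joined es v u
joined-sym es u v = does-⇔ (mk⇔ (Any.map flip) (Any.map flip)) (joined? es u v) (joined? es v u)
  where
  flip : ∀ {u v : Fin n} {e} → Joins u v e → Joins v u e
  flip (u≢v , u∈ , v∈) = u≢v ∘ sym , v∈ , u∈

joined-irrefl : ∀ es (v : Fin n) → joined es v v ≡ false
joined-irrefl es v = dec-false (joined? es v v) λ j → proj₁ (proj₂ (Any.satisfied j)) refl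

-- The neighbours of a hyperedge in the incidence graph to which the decomposition is applied.
pairs : Subset n → List (Subset n)
pairs {n} e = filter (λ p → (∣ p ∣ ≟ 2) ×-dec (p ⊆? e)) (subsets n)

∈-pairs : {p e : Subset n} → p ∈ˡ pairs e → ∣ p ∣ ≡ 2 × p ⊆ e
∈-pairs {n} {e = e} p∈ = proj₂ (∈-filter⁻ (λ p → (∣ p ∣ ≟ 2) ×-dec (p ⊆? e)) {xs = subsets n} p∈)

pairs-∈ : {p e : Subset n} → ∣ p ∣ ≡ 2 → p ⊆ e → p ∈ˡ pairs e
pairs-∈ {e = e} eq p⊆e = ∈-filter⁺ (λ p → (∣ p ∣ ≟ 2) ×-dec (p ⊆? e)) (subsets-complete _) (eq , λ {x} → p⊆e {x})

-- The bound for a hypergraph without a Berge-K_k.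

module BergeFreeHypergraph {r n k : ℕ} (H : Hypergraph (suc (suc r)) n) (free : BergeFree (K k) H)
  (matchings : Matchings.König (pairs {n}) (edges H)) where

  open Matchings (pairs {n})
  open Matching
  open König matchings

  P₁ P₂ : List (Subset n)
  P₁ = rights M₁
  P₂ = rights M₂

  M : List (Subset n × Subset n)
  M = M₁ ++ M₂

  matchM : Matching [] M
  matchM = matching-++⁺ M₁ match₁ match₂

  ∈M⇒∈pairs : ∀ {e p} → (e , p) ∈ˡ M → p ∈ˡ pairs e
  ∈M⇒∈pairs = All.lookup (isEdge matchM)

  split′ : edges H ↭ lefts M ++ F
  split′ = begin
    edges H                          ↭⟨ split ⟩
    (lefts M₁ ++ F) ++ lefts M₂      ≡⟨ ++-assoc (lefts M₁) F (lefts M₂) ⟩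
    lefts M₁ ++ F ++ lefts M₂        ↭⟨ ↭.++⁺ˡ (lefts M₁) (↭.++-comm F (lefts M₂)) ⟩
    lefts M₁ ++ lefts M₂ ++ F        ≡⟨ ++-assoc (lefts M₁) (lefts M₂) F ⟨
    (lefts M₁ ++ lefts M₂) ++ F      ≡⟨ cong (_++ F) (map-++ proj₁ M₁ M₂) ⟨
    lefts M ++ F                     ∎
    where open PermutationReasoning

  -- The hyperedges are distinct, hence so are the matched ones. This makes the edge map of the
  -- Berge copy injective.
  matched-once : ∀ {e p q} → (e , p) ∈ˡ M → (e , q) ∈ˡ M → p ≡ q
  matched-once = unique⇒functional (unique-++⁻ˡ (lefts M) (unique-↭ split′ (unique H)))

  blue red : Fin n → Fin n → Bool
  blue = joined P₁
  red  = joined P₂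

  size-P : ∀ {p} → p ∈ˡ rights M → ∣ p ∣ ≡ 2
  size-P p∈ with ∈-map⁻ proj₂ p∈
  ... | (e , p) , ep∈ , refl = proj₁ (∈-pairs {e = e} (∈M⇒∈pairs ep∈))

  P₁⊆P : ∀ {p} → p ∈ˡ P₁ → p ∈ˡ rights M
  P₁⊆P p∈ = subst (_ ∈ˡ_) (sym (map-++ proj₂ M₁ M₂)) (∈-++⁺ˡ p∈)

  P₂⊆P : ∀ {p} → p ∈ˡ P₂ → p ∈ˡ rights M
  P₂⊆P p∈ = subst (_ ∈ˡ_) (sym (map-++ proj₂ M₁ M₂)) (∈-++⁺ʳ P₁ p∈)

  joined⇒∈ : ∀ {es} → (∀ {p} → p ∈ˡ es → p ∈ˡ rights M) →
             ∀ {u v} (u≢v : u ≢ v) → joined es u v ≡ true → ⟪ u≢v ⟫ ∈ˡ es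
  joined⇒∈ {es} es⊆ u≢v j with find (joined⁻ es j)
  ... | p , p∈ , _ , u∈ , v∈ = subst (_∈ˡ es) (⟪⟫-unique u≢v (size-P (es⊆ p∈)) u∈ v∈) p∈

  -- A pair is determined by its two vertices, and `match₂` avoids the pairs in `P₁`.
  exclusive : ∀ u v → red u v ≡ true → blue u v ≡ false
  exclusive u v ru = dec-false (joined? P₁ u v) absurd
    where
    absurd : ¬ Any (Joins u v) P₁
    absurd j = All.lookup (avoids match₂) (joined⇒∈ P₂⊆P u≢v ru) (joined⇒∈ P₁⊆P u≢v (joined⁺ j))
      where
      u≢v : u ≢ v
      u≢v = proj₁ (proj₂ (Any.satisfied j))

  open Symmetrization red blue (joined-sym P₂) (joined-sym P₁) exclusive r

  adj-sym : ∀ u v → adj u v ≡ adj v u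
  adj-sym u v = cong₂ _∨_ (joined-sym P₂ u v) (joined-sym P₁ u v)

  adj-irrefl : ∀ v → adj v v ≡ false
  adj-irrefl v = cong₂ _∨_ (joined-irrefl P₂ v) (joined-irrefl P₁ v)

  adj⇒matched : ∀ {u v} (u≢v : u ≢ v) → adj u v ≡ true → ⟪ u≢v ⟫ ∈ˡ rights M
  adj⇒matched {u} {v} u≢v a with red u v in ru
  ... | true  = P₂⊆P (joined⇒∈ P₂⊆P u≢v ru)
  ... | false = P₁⊆P (joined⇒∈ P₁⊆P u≢v a)

  -- Each pair of the clique is sent to the hyperedge matched with it, which contains it because
  -- matching edges are incidences.
  clique⇒Berge : CliqueFree adj k
  clique⇒Berge φ adjacent = free (φ↣ , f↣ , inclusion)
    where
    -- Two points with the same image would force a loop in `adj`.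
    φ-injective : ∀ {x y} → φ x ≡ φ y → x ≡ y
    φ-injective {x} {y} eq with x ≟ᶠ y
    ... | yes x≡y = x≡y
    ... | no x≢y with () ← trans (sym (adjacent x≢y)) (trans (cong (adj (φ x)) (sym eq)) (adj-irrefl (φ x)))
    φ↣ : Fin k ↣ Fin n
    φ↣ = mk↣ {to = φ} φ-injective
    matched : ∀ i → ∃[ e ] ((e , image φ (K k ‼ i)) ∈ˡ M)
    matched i with two-elements (K k ‼ i) (All.lookup (uniform (K k)) (∈-lookup i))
    ... | u , v , u≢v , u∈ , v∈ with ∈-map⁻ proj₂ (adj⇒matched (u≢v ∘ φ-injective) (adjacent u≢v))
    ... | (e , _) , ep∈ , eq = e , subst (λ p → (e , p) ∈ˡ M)
      (trans (sym eq) (sym (⟪⟫-unique (u≢v ∘ φ-injective)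
        (trans (∣image∣ φ↣ _) (All.lookup (uniform (K k)) (∈-lookup i))) (∈-image⁺ φ u∈) (∈-image⁺ φ v∈)))) ep∈
    hyperedge∈ : ∀ i → proj₁ (matched i) ∈ˡ edges H
    hyperedge∈ i = ↭.∈-resp-↭ (↭-sym split′) (∈-++⁺ˡ (∈-map⁺ proj₁ (proj₂ (matched i))))
    f : E (K k) → E H
    f i = index (hyperedge∈ i)
    f-lookup : ∀ i → proj₁ (matched i) ≡ H ‼ f i
    f-lookup i = lookup-index (hyperedge∈ i)
    f↣ : E (K k) ↣ E H
    f↣ = mk↣ {to = f} λ {i} {j} eq → lookup-injective (unique (K k)) (image-injective φ↣
      (matched-once (proj₂ (matched i)) (subst (λ e → (e , image φ (K k ‼ j)) ∈ˡ M)
        (trans (f-lookup j) (trans (cong (H ‼_) (sym eq)) (sym (f-lookup i)))) (proj₂ (matched j)))))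
    inclusion : ∀ i → image φ (K k ‼ i) ⊆ H ‼ f i
    inclusion i = subst (image φ (K k ‼ i) ⊆_) (f-lookup i) (proj₂ (∈-pairs (∈M⇒∈pairs (proj₂ (matched i)))))

  vertices : List (Fin n × ℕ)
  vertices = map unit (tabulate id)

  -- By `closed`, every pair inside such a hyperedge lies in `P₁`, so the hyperedge is a blue
  -- clique, even when it is unmatched.
  blueCount : length (lefts M₁ ++ F) ≤ cliques blue (suc (suc r)) everywhere vertices
  blueCount = ≤-trans (unique⇒length≤-⊆ (unique-++⁻ˡ (lefts M₁ ++ F) (unique-↭ split (unique H))) (λ {e} e∈ → cliqueSets-complete blue _ everywhere id (isC e∈)))
    (≤-reflexive (length-cliqueSets blue (suc (suc r)) everywhere id))
    where
    isC : ∀ {e} → e ∈ˡ lefts M₁ ++ F → IsClique blue (suc (suc r)) everywhere id e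
    isC e∈ = isClique (All.lookup (uniform H) (↭.∈-resp-↭ (↭-sym split) (∈-++⁺ˡ e∈))) (λ _ → refl)
      λ x∈ y∈ x≢y → joined⁺ (lose (All.lookup (All.lookup closed e∈)
        (pairs-∈ (∣⟪⟫∣ x≢y) (⟪⟫-⊆ x≢y x∈ y∈))) (x≢y , ⟪⟫-∈ˡ x≢y , ⟪⟫-∈ʳ x≢y))

  redCount : length P₂ ≤ cliques red 2 everywhere vertices
  redCount = ≤-trans (unique⇒length≤-⊆ (distinct match₂) (λ p∈ → cliqueSets-complete red 2 everywhere id (isC p∈)))
    (≤-reflexive (length-cliqueSets red 2 everywhere id))
    where
    isC : ∀ {p} → p ∈ˡ P₂ → IsClique red 2 everywhere id p
    isC p∈ = isClique (size-P (P₂⊆P p∈)) (λ _ → refl) λ x∈ y∈ x≢y → joined⁺ (lose p∈ (x≢y , x∈ , y∈))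

  size≤value : size H ≤ value vertices
  size≤value = begin
    size H                                               ≡⟨ ↭.↭-length split ⟩
    length ((lefts M₁ ++ F) ++ lefts M₂)         ≡⟨ length-++ (lefts M₁ ++ F) ⟩
    length (lefts M₁ ++ F) + length (lefts M₂)   ≡⟨ cong (length (lefts M₁ ++ F) +_) (trans (length-map proj₁ M₂) (sym (length-map proj₂ M₂))) ⟩
    length (lefts M₁ ++ F) + length P₂               ≤⟨ +-mono-≤ blueCount redCount ⟩
    cliques blue (suc (suc r)) everywhere vertices + cliques red 2 everywhere vertices ≡⟨ +-comm (cliques blue (suc (suc r)) everywhere vertices) _ ⟩
    value vertices                                       ∎
    where open ≤-Reasoning

  bergeFree-bound : size H ≤ ex n (K k) ⊔ exCopies n (K (suc (suc r))) (K k)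
  bergeFree-bound = conclude (symmetrize _ vertices ≤-refl)
    where
    open ≤-Reasoning
    -- The starting weights are all 1, so the total weight is the number of vertices of the final
    -- blow-up.
    total : ∀ m {V : Set} (g : Fin m → V) → sum (weights (map unit (tabulate g))) ≡ m
    total zero    g = refl
    total (suc m) g = cong suc (total m (g ∘ suc))
    conclude : ∃[ L ] (value vertices ≤ value L × sum (weights vertices) ≡ sum (weights L) ×
                       AllPairs (λ x y → adj (proj₁ x) (proj₁ y) ≡ true) L) →
               size H ≤ ex n (K k) ⊔ exCopies n (K (suc (suc r))) (K k)
    conclude (L , value≤ , weight≡ , pairwise) = begin
      size H                                                  ≤⟨ size≤value ⟩
      value vertices                                          ≤⟨ value≤ ⟩
      value L                                                 ≤⟨ monochromatic L ⟩
      esym 2 (weights L) ⊔ esym (suc (suc r)) (weights L)     ≤⟨ esym-realized adj adj-sym adj-irrefl clique⇒Berge (suc (suc r)) L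
                                                                   (trans (length-copiesOf L) (trans (sym weight≡) (total n id))) pairwise ⟩
      ex n (K k) ⊔ exCopies n (K (suc (suc r))) (K k)         ∎

theorem19 : ∀ (n k r : ℕ) → 1 ≤ n → 2 ≤ k → 2 ≤ r →
    exBerge r n (K k) ≤ ex n (K k) ⊔ exCopies n (K r) (K k)
-- The maximum of a list with default 0 is bounded entry by entry, and 0 satisfies the bound
-- trivially.
theorem19 n k (suc (suc r)) _ _ (s≤s (s≤s z≤n)) = max≤v⁺ z≤n (All.map⁺ (All.tabulate λ {H} H∈ →
  BergeFreeHypergraph.bergeFree-bound H (proj₂ (∈-filter⁻ (bergeFree? (K k)) {xs = hypergraphs (suc (suc r)) n} H∈)) (Matchings.könig-exists (pairs {n}) _≟ˢ_ (edges H))))
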